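{- Let $m,k\ge 1$ be integers, and let $N'_{m,k}(\alpha,\beta)=\sum_T\mathrm{wt}(T)$, summed over all Condensed Catalan tableaux $T$ of size $(k,k+m)$ whose shape $\lambda=(\lambda_1,\ldots,\lambda_k)$ satisfies $\lambda_1=m$ and $\lambda_k\ge 1$ (i.e. exactly $k$ nonzero rows and first row of length $m$). Then $$N'_{m,k}(\alpha,\beta)=\alpha^k\beta^m\sum_{\ell=0}^{k}\sum_{j=0}^{m}\alpha^j\beta^\ell\left(\binom{m+\ell-2+\delta_{jm}}{m-1}\binom{k+j-2+\delta_{\ell k}}{k-1}-\binom{m+\ell-2+\delta_{jm}}{m}\binom{k+j-2+\delta_{\ell k}}{k}\right),$$ where $\delta_{rs}$ is the Kronecker delta.
   Context: Binomial coefficients are $\binom{a}{b}=a(a-1)\cdots(a-b+1)/b!$ for integers $a$ and $b\ge 0$, and $\binom{a}{b}=0$ for $b<0$. For a partition $\lambda=(\lambda_1\ge\cdots\ge\lambda_k\ge 0)$ with $\lambda_1\le n-k$, the Young diagram (English convention) consists of boxes $(r,c)$, $1\le r\le k$, $1\le c\le\lambda_r$ (row 1 on top, column 1 leftmost), viewed inside a $k\times(n-k)$ rectangle. A Condensed Catalan tableau of size $(k,n)$ and shape $\lambda$ is an assignment to each box of one of $\alpha$, $\beta$, or empty, such that: (ii) if box $(r,c)$ contains $\beta$, every box $(r,c')$ with $c'<c$ is empty; (iii) if box $(r,c)$ contains $\alpha$, every box $(r',c)$ with $r'<r$ is empty; (iv) every box $(r,c)$ such that there is no $\alpha$ in any box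 $(r',c)$ with $r'>r$ and no $\beta$ in any box $(r,c')$ with $c'>c$ contains $\alpha$ or $\beta$. Its weight is $\mathrm{wt}(T)=\alpha^{k+a}\beta^{n-k+b}$, where $a$ and $b$ are the numbers of $\alpha$'s and $\beta$'s in the filling. -}

module Defs where

open import Algebra.Bundles using (CommutativeRing; Semiring)
open import Data.Bool.Base using (if_then_else_)
open import Data.Fin.Base as Fin using (Fin; toℕ)
open import Data.Fin.Properties using (all?; any?; _<?_)
open import Data.Integer.Base as ℤ using (ℤ; +_; -[1+_]; 0ℤ; 1ℤ)
open import Data.List.Base as List using (List; []; _∷_; [_]; upTo; filter; foldr; cartesianProductWith; concatMap)
open import Data.Nat.Base using (ℕ; zero; suc; _+_; _∸_; _≤_; _≥_; _!; NonZero)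
open import Data.Nat.Properties as ℕ using (_!≢0)
open import Data.Product.Base using (Σ-syntax; ∃-syntax; _×_; _,_; proj₁; proj₂)
open import Data.Sum.Base using (_⊎_)
open import Data.Vec.Base as Vec using (Vec; []; _∷_)
open import Data.Vec.Relation.Unary.All as All using (All; []; _∷_)
open import Data.Vec.Relation.Unary.All.Properties using (lookup⁺)
open import Data.Vec.Relation.Unary.Linked using (Linked; linked?)
open import Relation.Binary.Definitions using (DecidableEquality)
open import Relation.Binary.PropositionalEquality.Core using (_≡_; refl)
open import Relation.Nullary using (Dec; yes; no; does; ¬_)
open import Relation.Nullary.Decidable using (_×-dec_; _⊎-dec_; _→-dec_; ¬?)
open import Function.Base using (_∘_)

fallingFactorial : ℤ → ℕ → ℤ
fallingFactorial a zero    = 1ℤ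
fallingFactorial a (suc b) = fallingFactorial a b ℤ.* (a ℤ.- + b)

-- The upper argument may be negative, and b ! always divides
-- a (a - 1) ⋯ (a - b + 1), so the division is exact.
binom : ℤ → ℤ → ℤ
binom a (+ b)    = ℤ._/ℕ_ (fallingFactorial a b) (b !) {{b !≢0}}
binom a -[1+ _ ] = 0ℤ

δ : ℕ → ℕ → ℤ
δ r s = if does (r ℕ.≟ s) then 1ℤ else 0ℤ

data Cell : Set where
  αᶜ βᶜ empty : Cell

infix 4 _≟ᶜ_
_≟ᶜ_ : DecidableEquality Cell
αᶜ     ≟ᶜ αᶜ     = yes refl
αᶜ     ≟ᶜ βᶜ     = no λ ()
αᶜ     ≟ᶜ empty = no λ ()
βᶜ     ≟ᶜ αᶜ     = no λ ()
βᶜ     ≟ᶜ βᶜ     = yes refl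
βᶜ     ≟ᶜ empty = no λ ()
empty ≟ᶜ αᶜ     = no λ ()
empty ≟ᶜ βᶜ     = no λ ()
empty ≟ᶜ empty = yes refl

-- The r-th row of a filling of μ is a vector of exactly μ_r cells, so that
-- Fin (lookup μ r) indexes the boxes of row r.  Rows and columns are
-- numbered from 0.
Filling : ∀ {k} → Vec ℕ k → Set
Filling μ = All (Vec Cell) μ

Filled : ℕ → Set
Filled k = Σ[ μ ∈ Vec ℕ k ] Filling μ

-- Since the parts decrease weakly, bounding all of them by n - k is the same
-- as bounding the first.
IsShape : ∀ k → ℕ → Vec ℕ k → Set
IsShape k n μ = Linked _≥_ μ × All (_≤ n ∸ k) μ

module _ {k} {μ : Vec ℕ k} (T : Filling μ) where

  Col : Fin k → Set
  Col r = Fin (Vec.lookup μ r)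

  entry : (r : Fin k) → Col r → Cell
  entry r c = Vec.lookup (lookup⁺ T r) c

  LeftOfβEmpty : Set
  LeftOfβEmpty = ∀ r (c c′ : Col r) → c′ Fin.< c →
                 entry r c ≡ βᶜ → entry r c′ ≡ empty

  AboveαEmpty : Set
  AboveαEmpty = ∀ r r′ (c : Col r) (c′ : Col r′) → r′ Fin.< r → toℕ c′ ≡ toℕ c →
                entry r c ≡ αᶜ → entry r′ c′ ≡ empty

  αBelow : (r : Fin k) → Col r → Set
  αBelow r c = ∃[ r′ ] Σ[ c′ ∈ Col r′ ] (r Fin.< r′ × toℕ c′ ≡ toℕ c × entry r′ c′ ≡ αᶜ)

  βRight : (r : Fin k) → Col r → Set
  βRight r c = ∃[ c′ ] (c Fin.< c′ × entry r c′ ≡ βᶜ)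

  FreeFilled : Set
  FreeFilled = ∀ r (c : Col r) → ¬ αBelow r c → ¬ βRight r c →
                 entry r c ≡ αᶜ ⊎ entry r c ≡ βᶜ

  IsCondensedCatalan : Set
  IsCondensedCatalan = LeftOfβEmpty × AboveαEmpty × FreeFilled

  αBelow? : ∀ r c → Dec (αBelow r c)
  αBelow? r c = any? λ r′ → any? λ c′ →
    r <? r′ ×-dec toℕ c′ ℕ.≟ toℕ c ×-dec entry r′ c′ ≟ᶜ αᶜ

  βRight? : ∀ r c → Dec (βRight r c)
  βRight? r c = any? λ c′ → c <? c′ ×-dec entry r c′ ≟ᶜ βᶜ

  isCondensedCatalan? : Dec IsCondensedCatalan
  isCondensedCatalan? =
    (all? λ r → all? λ c → all? λ c′ →
       c′ <? c →-dec entry r c ≟ᶜ βᶜ →-dec entry r c′ ≟ᶜ empty)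
    ×-dec
    (all? λ r → all? λ r′ → all? λ c → all? λ c′ →
       r′ <? r →-dec toℕ c′ ℕ.≟ toℕ c →-dec entry r c ≟ᶜ αᶜ →-dec entry r′ c′ ≟ᶜ empty)
    ×-dec
    (all? λ r → all? λ c →
       ¬? (αBelow? r c) →-dec ¬? (βRight? r c) →-dec (entry r c ≟ᶜ αᶜ ⊎-dec entry r c ≟ᶜ βᶜ))

IsTableau : ∀ k → ℕ → Filled k → Set
IsTableau k n (μ , T) = IsShape k n μ × IsCondensedCatalan T

isTableau? : ∀ k n (T : Filled k) → Dec (IsTableau k n T)
isTableau? k n (μ , T) =
  (linked? ℕ._≥?_ μ ×-dec All.all? (ℕ._≤? (n ∸ k)) μ) ×-dec isCondensedCatalan? T

words : ∀ {A : Set} → List A → ∀ k → List (Vec A k)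
words xs zero    = [ [] ]
words xs (suc k) = cartesianProductWith _∷_ xs (words xs k)

fillings : ∀ {k} (μ : Vec ℕ k) → List (Filling μ)
fillings []      = [ [] ]
fillings (p ∷ μ) = cartesianProductWith _∷_ (words (αᶜ ∷ βᶜ ∷ empty ∷ []) p) (fillings μ)

-- Each condensed Catalan tableau of size (k , n) occurs exactly once: the
-- list before filtering has every vector of k parts ≤ n - k, with every
-- filling.
tableaux : ∀ k n → List (Filled k)
tableaux k n = filter (isTableau? k n)
  (concatMap (λ μ → List.map (μ ,_) (fillings μ)) (words (upTo (suc (n ∸ k))) k))

count : Cell → ∀ {k} → Filled k → ℕ
count x (_ , T) = Vec.sum (All.reduce (Vec.count (_≟ᶜ x)) T)

IsFull : ∀ {k} .{{_ : NonZero k}} → ℕ → Vec ℕ k → Set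
IsFull {suc _} m μ = Vec.head μ ≡ m × 1 ≤ Vec.last μ

isFull? : ∀ {k} .{{_ : NonZero k}} m (μ : Vec ℕ k) → Dec (IsFull m μ)
isFull? {suc _} m μ = Vec.head μ ℕ.≟ m ×-dec 1 ℕ.≤? Vec.last μ

-- A polynomial identity in ℤ[α , β] holds exactly when it holds for all
-- α and β in every commutative ring.
module Over {c ℓ} (R : CommutativeRing c ℓ) where

  open CommutativeRing R
    using (Carrier; 0#; 1#; -_; semiring) renaming (_+_ to _⊕_; _*_ to _⊛_)
  open Semiring semiring using (rawSemiring)
  open import Algebra.Definitions.RawSemiring rawSemiring public
    using (_^_)
  open import Algebra.Definitions.RawSemiring rawSemiring
    using (sum) renaming (_×_ to _·_)

  fromℤ : ℤ → Carrier
  fromℤ (+ n)    = n · 1#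
  fromℤ -[1+ n ] = - (suc n · 1#)

  ∑≤ : ℕ → (ℕ → Carrier) → Carrier
  ∑≤ n f = sum {suc n} (f ∘ toℕ)

  wt : Carrier → Carrier → ∀ k → ℕ → Filled k → Carrier
  wt α β k n T = (α ^ (k + count αᶜ T)) ⊛ (β ^ (n ∸ k + count βᶜ T))

  N′ : ∀ m k .{{_ : NonZero k}} → Carrier → Carrier → Carrier
  N′ m k α β = foldr _⊕_ 0# (List.map (wt α β k (k + m))
    (filter (isFull? m ∘ proj₁) (tableaux k (k + m))))

{-# OPTIONS --safe #-}

-- Build a tableau row by row, from the bottom up, and call a column free if it
-- contains no α yet.  Read from the right, a row is forced to put α in the free
-- columns until it puts a single β, after which it is empty.  Hence a row with
-- f free columns is determined by the number j ≤ f of its α's, it contains a β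
-- exactly when j < f, and it leaves f - j free columns.  Let W(k, m, j, l) count
-- the tableaux with k rows, first row of length m, j α's and l β's.  The row above
-- may be longer, so W(k + 1, m, j, l + 1) for j < m, as well as W(k + 1, m, j, l)
-- for j = m, is the sum of W(k, m′, i, l) over all m′ ≤ m and i ≤ j.  These double
-- prefix sums have a closed form of the same shape as the coefficients of the
-- theorem, which follows by taking mixed differences and applying Pascal's rule.
module Submission where

open import Defs
open import Algebra.Bundles using (CommutativeRing)
open import Data.Integer.Base as ℤ using (+_)
open import Data.Nat.Base using (ℕ; NonZero)

-- Since no two α's share a column, a tableau with first row of length p and j α's leaves exactly p
-- - j free columns. An arbitrary weight `φ` on the number of free columns therefore remembers j,
-- and putting a row on top becomes a linear operation on `φ`. The obstacle is that a longer upper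
-- row gains free columns that the rows below never met. The operator `widen` absorbs one such
-- column into `φ`, so that the sum over all lengths of the second row can be taken by induction on
-- the length of the top row, for all `φ` at once. On the side of the coefficients, the mixed
-- difference has no predecessor at j = 0 or at width one, and at j = m the Kronecker delta changes
-- the formula. Hence the separate corner, edge, side and origin identities.

module Coefficients where

  open import Data.Bool.Base using (if_then_else_)
  open import Data.Integer.Base as ℤ using (ℤ; 0ℤ; 1ℤ)
  import Data.Integer.Properties as ℤ
  open import Data.Integer.Tactic.RingSolver using (solve-∀)
  open import Data.Nat.Base
  open import Data.Nat.Combinatorics using (_C_; nCn≡1; k>n⇒nCk≡0; nCk≡nC[n∸k]; nCk+nC[k+1]≡[n+1]C[k+1])
  open import Data.Nat.DivMod using (m*n/n≡m)
  open import Data.Nat.Properties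
  open import Data.Product.Base using (∃; _×_; _,_)
  open import Data.Sum.Base using (_⊎_; inj₁; inj₂)
  open import Relation.Binary.PropositionalEquality
  open import Relation.Nullary using (does; yes; no)
  open import Relation.Nullary.Decidable using (dec-true; dec-false)

  -- Integer binomials at natural upper index, and a shifted variant.

  fallingFactorial-suc : ∀ a b →
    fallingFactorial (1ℤ ℤ.+ a) (suc b) ≡ (1ℤ ℤ.+ a) ℤ.* fallingFactorial a b
  fallingFactorial-suc a zero    = lemma a
    where
    lemma : ∀ a → 1ℤ ℤ.* (1ℤ ℤ.+ a ℤ.- 0ℤ) ≡ (1ℤ ℤ.+ a) ℤ.* 1ℤ
    lemma = solve-∀
  fallingFactorial-suc a (suc b) = begin
    fallingFactorial (1ℤ ℤ.+ a) (suc b) ℤ.* (1ℤ ℤ.+ a ℤ.- + suc b)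
      ≡⟨ cong (ℤ._* (1ℤ ℤ.+ a ℤ.- + suc b)) (fallingFactorial-suc a b) ⟩
    (1ℤ ℤ.+ a) ℤ.* fallingFactorial a b ℤ.* (1ℤ ℤ.+ a ℤ.- (1ℤ ℤ.+ + b))
      ≡⟨ lemma a (fallingFactorial a b) (+ b) ⟩
    (1ℤ ℤ.+ a) ℤ.* (fallingFactorial a b ℤ.* (a ℤ.- + b)) ∎
    where
    open ≡-Reasoning
    lemma : ∀ a f b → (1ℤ ℤ.+ a) ℤ.* f ℤ.* (1ℤ ℤ.+ a ℤ.- (1ℤ ℤ.+ b)) ≡
                      (1ℤ ℤ.+ a) ℤ.* (f ℤ.* (a ℤ.- b))
    lemma = solve-∀

  -- This is Pascal's rule multiplied by (b + 1)!: the top factor n + 1 splits as (b + 1) + (n - b),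
  -- one part for each summand.
  fallingFactorial≡C*! : ∀ n b → fallingFactorial (+ n) b ≡ + ((n C b) * b !)
  fallingFactorial≡C*! n       zero    = refl
  fallingFactorial≡C*! zero    (suc b) =
    trans (zero-factor b) (cong (λ x → + (x * suc b !)) (sym (k>n⇒nCk≡0 {0} {suc b} z<s)))
    where
    zero-factor : ∀ b → fallingFactorial 0ℤ (suc b) ≡ 0ℤ
    zero-factor zero    = refl
    zero-factor (suc b) = cong (ℤ._* (0ℤ ℤ.- + suc b)) (zero-factor b)
  fallingFactorial≡C*! (suc n) (suc b) = begin
    fallingFactorial (1ℤ ℤ.+ + n) (suc b)
      ≡⟨ fallingFactorial-suc (+ n) b ⟩
    (1ℤ ℤ.+ + n) ℤ.* f
      ≡⟨ lemma (+ n) (+ b) f ⟩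
    (1ℤ ℤ.+ + b) ℤ.* f ℤ.+ f ℤ.* (+ n ℤ.- + b)
      ≡⟨ cong₂ (λ x y → (1ℤ ℤ.+ + b) ℤ.* x ℤ.+ y) (fallingFactorial≡C*! n b) (fallingFactorial≡C*! n (suc b)) ⟩
    + suc b ℤ.* + ((n C b) * b !) ℤ.+ + ((n C suc b) * suc b !)
      ≡⟨ cong (λ x → x ℤ.+ + ((n C suc b) * suc b !)) (ℤ.pos-* (suc b) ((n C b) * b !)) ⟨
    + (suc b * ((n C b) * b !) + (n C suc b) * suc b !)
      ≡⟨ cong (λ x → + (x + (n C suc b) * suc b !))
          (trans (sym (*-assoc (suc b) (n C b) (b !)))
            (trans (cong (_* b !) (*-comm (suc b) (n C b))) (*-assoc (n C b) (suc b) (b !)))) ⟩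
    + ((n C b) * suc b ! + (n C suc b) * suc b !)
      ≡⟨ cong +_ (*-distribʳ-+ (suc b !) (n C b) (n C suc b)) ⟨
    + ((n C b + n C suc b) * suc b !)
      ≡⟨ cong (λ x → + (x * suc b !)) (nCk+nC[k+1]≡[n+1]C[k+1] n b) ⟩
    + ((suc n C suc b) * suc b !) ∎
    where
    open ≡-Reasoning
    f = fallingFactorial (+ n) b
    lemma : ∀ n b f → (1ℤ ℤ.+ n) ℤ.* f ≡ (1ℤ ℤ.+ b) ℤ.* f ℤ.+ f ℤ.* (n ℤ.- b)
    lemma = solve-∀

  binom≡C : ∀ n b → binom (+ n) (+ b) ≡ + (n C b)
  binom≡C n b rewrite fallingFactorial≡C*! n b = cong +_ (m*n/n≡m (n C b) (b !) {{b !≢0}})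

  -- The binomial coefficient of a - 1 over n, except that it vanishes at a = 0;
  -- this does not change the coefficients of the theorem (see coeff≡binom).
  predC : ℕ → ℕ → ℕ
  predC zero    _ = 0
  predC (suc a) n = a C n

  predC-pascal : ∀ a n → predC (suc a) (suc n) ≡ predC a n + predC a (suc n)
  predC-pascal zero    n = k>n⇒nCk≡0 {0} {suc n} z<s
  predC-pascal (suc a) n = sym (nCk+nC[k+1]≡[n+1]C[k+1] a n)

  predC-zero : ∀ {a n} → a ≤ n → predC a n ≡ 0
  predC-zero {zero}  _   = refl
  predC-zero {suc a} a<n = k>n⇒nCk≡0 a<n

  predC-sym : ∀ a b → predC (suc (a + b)) a ≡ predC (suc (a + b)) b
  predC-sym a b = trans (nCk≡nC[n∸k] (m≤m+n a b)) (cong ((a + b) C_) (m+n∸m≡n a b))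

  -- A 2 by 2 determinant of shifted binomials. It is linear in the pair belonging to `x` and in the
  -- pair belonging to `y`, so Pascal's rule passes to it on either side.
  D : ℕ → ℕ → ℕ → ℕ → ℤ
  D x m y k = + predC x m ℤ.* + predC y k ℤ.- + predC x (suc m) ℤ.* + predC y (suc k)

  D-pascalˡ : ∀ x m y k → D (suc x) (suc m) y k ≡ D x m y k ℤ.+ D x (suc m) y k
  D-pascalˡ x m y k rewrite predC-pascal x m | predC-pascal x (suc m) =
    lemma (+ predC x m) (+ predC x (suc m)) (+ predC x (suc (suc m))) (+ predC y k) (+ predC y (suc k))
    where
    lemma : ∀ a b c d e → (a ℤ.+ b) ℤ.* d ℤ.- (b ℤ.+ c) ℤ.* e ≡
      (a ℤ.* d ℤ.- b ℤ.* e) ℤ.+ (b ℤ.* d ℤ.- c ℤ.* e)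
    lemma = solve-∀

  D-sym : ∀ x m y k → D x m y k ≡ D y k x m
  D-sym x m y k = cong₂ ℤ._-_ (ℤ.*-comm (+ predC x m) _) (ℤ.*-comm (+ predC x (suc m)) _)

  D-pascalʳ : ∀ x m y k → D x m (suc y) (suc k) ≡ D x m y k ℤ.+ D x m y (suc k)
  D-pascalʳ x m y k = trans (D-sym x m (suc y) (suc k))
    (trans (D-pascalˡ y k x m) (cong₂ ℤ._+_ (D-sym y k x m) (D-sym y (suc k) x m)))

  𝟙 : ℕ → ℕ → ℕ
  𝟙 r s = if does (r ≟ s) then 1 else 0

  𝟙-refl : ∀ n → 𝟙 n n ≡ 1
  𝟙-refl n = cong (if_then 1 else 0) (dec-true (n ≟ n) refl)

  𝟙-≢ : ∀ {r s} → r ≢ s → 𝟙 r s ≡ 0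
  𝟙-≢ {r} {s} r≢s = cong (if_then 1 else 0) (dec-false (r ≟ s) r≢s)

  -- The coefficient of α^j β^l for m + 1 columns and k + 1 rows.
  coeff : ℕ → ℕ → ℕ → ℕ → ℤ
  coeff m k j l = D (m + l + 𝟙 j (suc m)) m (k + j + 𝟙 l (suc k)) k

  -- For k ≥ 1, the sum over all m′ ≤ m + 1 and i ≤ j of the coefficients of
  -- α^i β^l for m′ columns and k rows.
  prefixCoeff : ℕ → ℕ → ℕ → ℕ → ℤ
  prefixCoeff m k j l = D (suc (m + l)) m (k + j + 𝟙 l k) k

  D-vanishˡ : ∀ {x m} y k → x ≤ m → D x m y k ≡ 0ℤ
  D-vanishˡ y k x≤m rewrite predC-zero x≤m | predC-zero (m≤n⇒m≤1+n x≤m) = refl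

  -- A column left free forces a β in the top row, so l = 0 is impossible; in the formula, the left
  -- upper argument drops to `m`.
  coeff-zero : ∀ m k j → j < suc m → coeff m k j 0 ≡ 0ℤ
  coeff-zero m k j j<m rewrite 𝟙-≢ (<⇒≢ j<m) =
    D-vanishˡ (k + j + 0) k (≤-reflexive (trans (+-identityʳ _) (+-identityʳ m)))

  coeff-suc : ∀ m k j l → j < suc m → coeff m k j (suc l) ≡ prefixCoeff m k j l
  coeff-suc m k j l j<m rewrite 𝟙-≢ (<⇒≢ j<m) = cong (λ x → D x m (k + j + 𝟙 l k) k) (trans (+-identityʳ _) (+-suc m l))

  -- With n = m + k + 1, symmetry gives C(n, k) = C(n, m + 1) and C(n, m) = C(n, k + 1), so the two
  -- products of the determinant coincide.
  D-antidiagonal : ∀ m k → D (suc (m + suc k)) m (suc (m + suc k)) k ≡ 0ℤ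
  D-antidiagonal m k = ℤ.i≡j⇒i-j≡0
    (trans (ℤ.*-comm (+ x m) (+ x k)) (cong₂ (λ a b → + a ℤ.* + b) x-k (predC-sym m (suc k))))
    where
    x = predC (suc (m + suc k))
    x-k : x k ≡ x (suc m)
    x-k rewrite +-suc m k = sym (predC-sym (suc m) k)

  -- The sides differ only at l = k, where the right upper argument of `prefixCoeff` is larger by
  -- one. By Pascal's rule the gap is an antidiagonal determinant, which vanishes.
  coeff-diag : ∀ m k l → l ≤ k → coeff m k (suc m) l ≡ prefixCoeff m k (suc m) l
  coeff-diag m k l l≤k rewrite 𝟙-refl m | 𝟙-≢ (<⇒≢ (s≤s l≤k)) | +-comm (m + l) 1 with l ≟ k
  ... | no l≢k rewrite 𝟙-≢ l≢k = refl
  ... | yes refl rewrite 𝟙-refl l | +-identityʳ (k + suc m) | +-comm (k + suc m) 1 | +-suc k m = lemma k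
    where
    lemma : ∀ k → D (suc (m + k)) m (suc (k + m)) k ≡ D (suc (m + k)) m (suc (suc (k + m))) k
    lemma zero rewrite predC-zero {suc (m + 0)} {suc m} (s≤s (≤-reflexive (+-identityʳ m))) = refl
    lemma (suc k) = begin
      D x m y (suc k)               ≡⟨ ℤ.+-identityˡ (D x m y (suc k)) ⟨
      0ℤ ℤ.+ D x m y (suc k)         ≡⟨ cong (ℤ._+ D x m y (suc k)) (D-antidiagonal m k) ⟨
      D x m x k ℤ.+ D x m y (suc k)  ≡⟨ cong (λ y′ → D x m y′ k ℤ.+ D x m y (suc k)) (cong suc (+-comm m (suc k))) ⟩
      D x m y k ℤ.+ D x m y (suc k)  ≡⟨ D-pascalʳ x m y k ⟨
      D x m (suc y) (suc k)         ∎
      where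
      open ≡-Reasoning
      x = suc (m + suc k)
      y = suc (suc k + m)

  -- If α's use up every column, the top row has no β, so the β's cannot be as many as the rows.
  coeff-diag-last : ∀ m k → coeff m k (suc m) (suc k) ≡ 0ℤ
  coeff-diag-last m k = trans
    (cong₂ (λ x y → D x m y k) (cong (λ d → m + suc k + d) (𝟙-refl m)) (cong (λ d → k + suc m + d) (𝟙-refl k)))
    (trans (cong₂ (λ x y → D x m y k) (+-comm (m + suc k) 1) y≡) (D-antidiagonal m k))
    where
    y≡ : k + suc m + 1 ≡ suc (m + suc k)
    y≡ rewrite +-comm (k + suc m) 1 | +-suc k m | +-suc m k | +-comm k m = refl

  -- Expand both determinants with left arguments `suc x` and `suc m` by Pascal's rule on the left,
  -- then the remaining one by Pascal's rule on the right; the same four terms appear on both sides.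
  D-corner : ∀ x m y k →
    D x (suc m) y k ℤ.+ (D (suc x) (suc m) y (suc k) ℤ.+ D x m (suc y) (suc k)) ≡
    D (suc x) (suc m) (suc y) (suc k) ℤ.+ D x m y (suc k)
  D-corner x m y k = begin
    a ℤ.+ (D (suc x) (suc m) y (suc k) ℤ.+ d) ≡⟨ cong (λ e → a ℤ.+ (e ℤ.+ d)) (D-pascalˡ x m y (suc k)) ⟩
    a ℤ.+ (b ℤ.+ c ℤ.+ d)                     ≡⟨ lemma a b c d ⟩
    d ℤ.+ (a ℤ.+ c) ℤ.+ b                     ≡⟨ cong (λ e → d ℤ.+ e ℤ.+ b) (D-pascalʳ x (suc m) y k) ⟨
    d ℤ.+ D x (suc m) (suc y) (suc k) ℤ.+ b   ≡⟨ cong (ℤ._+ b) (D-pascalˡ x m (suc y) (suc k)) ⟨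
    D (suc x) (suc m) (suc y) (suc k) ℤ.+ b   ∎
    where
    open ≡-Reasoning
    a = D x (suc m) y k
    b = D x m y (suc k)
    c = D x (suc m) y (suc k)
    d = D x m (suc y) (suc k)
    lemma : ∀ a b c d → a ℤ.+ (b ℤ.+ c ℤ.+ d) ≡ d ℤ.+ (a ℤ.+ c) ℤ.+ b
    lemma = solve-∀

  D-cong : ∀ {x x′ y y′} m k → x ≡ x′ → y ≡ y′ → D x m y k ≡ D x′ m y′ k
  D-cong m k = cong₂ (λ x y → D x m y k)

  D-congʳ : ∀ x {y y′} m k → y ≡ y′ → D x m y k ≡ D x m y′ k
  D-congʳ x m k = cong (λ y → D x m y k)

  -- Inclusion-exclusion on the rectangle of pairs (m′, i). The hypothesis keeps `suc j` below the
  -- number m + 2 of columns, so the delta comparing these two vanishes.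
  prefixCoeff-corner : ∀ m k j l → j < suc m →
    coeff (suc m) k (suc j) l ℤ.+ (prefixCoeff (suc m) (suc k) j l ℤ.+ prefixCoeff m (suc k) (suc j) l) ≡
    prefixCoeff (suc m) (suc k) (suc j) l ℤ.+ prefixCoeff m (suc k) j l
  prefixCoeff-corner m k j l j<m = begin
    coeff (suc m) k (suc j) l ℤ.+ (D (suc x) (suc m) y (suc k) ℤ.+ D x m (suc k + suc j + e) (suc k))
      ≡⟨ cong₂ (λ a b → a ℤ.+ (D (suc x) (suc m) y (suc k) ℤ.+ b))
           (D-cong (suc m) k x≡ y≡) (D-congʳ x m (suc k) (cong suc y≡)) ⟩
    D x (suc m) y k ℤ.+ (D (suc x) (suc m) y (suc k) ℤ.+ D x m (suc y) (suc k))
      ≡⟨ D-corner x m y k ⟩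
    D (suc x) (suc m) (suc y) (suc k) ℤ.+ D x m y (suc k)
      ≡⟨ cong (ℤ._+ D x m y (suc k)) (D-congʳ (suc x) (suc m) (suc k) (cong suc y≡)) ⟨
    D (suc x) (suc m) (suc k + suc j + e) (suc k) ℤ.+ D x m y (suc k) ∎
    where
    open ≡-Reasoning
    e = 𝟙 l (suc k)
    x = suc (m + l)
    y = suc k + j + e
    x≡ : suc m + l + 𝟙 (suc j) (suc (suc m)) ≡ x
    x≡ = trans (cong (λ d → suc m + l + d) (𝟙-≢ (<⇒≢ (s≤s j<m)))) (+-identityʳ x)
    y≡ : k + suc j + e ≡ y
    y≡ = cong (_+ e) (+-suc k j)

  -- Only the full width m + 1 has room for m + 1 α's, so the last step in j adds a single
  -- coefficient. The delta is 1 here, and one Pascal step on the right suffices.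
  prefixCoeff-edge : ∀ m k l →
    coeff m k (suc m) l ℤ.+ prefixCoeff m (suc k) m l ≡ prefixCoeff m (suc k) (suc m) l
  prefixCoeff-edge m k l = begin
    coeff m k (suc m) l ℤ.+ D x m y (suc k)
      ≡⟨ cong (ℤ._+ D x m y (suc k)) (D-cong m k x≡ y≡) ⟩
    D x m y k ℤ.+ D x m y (suc k)
      ≡⟨ D-pascalʳ x m y k ⟨
    D x m (suc y) (suc k)
      ≡⟨ D-congʳ x m (suc k) (cong suc y≡) ⟨
    D x m (suc k + suc m + e) (suc k) ∎
    where
    open ≡-Reasoning
    e = 𝟙 l (suc k)
    x = suc (m + l)
    y = suc k + m + e
    x≡ : m + l + 𝟙 (suc m) (suc m) ≡ x
    x≡ = trans (cong (λ d → m + l + d) (𝟙-refl m)) (+-comm (m + l) 1)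
    y≡ : k + suc m + e ≡ y
    y≡ = cong (_+ e) (+-suc k m)

  predC-𝟙 : ∀ k l → predC (k + 𝟙 l (suc k)) k ≡ 𝟙 l (suc k)
  predC-𝟙 k l with l ≟ suc k
  ... | no l≢k rewrite 𝟙-≢ l≢k = predC-zero (≤-reflexive (+-identityʳ k))
  ... | yes refl rewrite 𝟙-refl k | +-comm k 1 = nCn≡1 k

  𝟙≤1 : ∀ r s → 𝟙 r s ≤ 1
  𝟙≤1 r s with r ≟ s
  ... | yes refl = ≤-reflexive (𝟙-refl r)
  ... | no r≢s = ≤-trans (≤-reflexive (𝟙-≢ r≢s)) z≤n

  -- On both sides the first right factor equals the Kronecker delta and the second is zero. This
  -- stands in for Pascal's rule at j = 0: it raises the right pair without an extra term.
  D-side : ∀ x m k l →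
    D x m (k + 𝟙 l (suc k)) k ≡ D x m (suc (k + 𝟙 l (suc k))) (suc k)
  D-side x m k l
    rewrite predC-𝟙 k l | predC-𝟙 (suc k) (suc l)
          | predC-zero {k + 𝟙 l (suc k)} {suc k} (≤-trans (+-monoʳ-≤ k (𝟙≤1 l (suc k))) (≤-reflexive (+-comm k 1)))
          | predC-zero {suc k + 𝟙 l (suc k)} {suc (suc k)}
              (≤-trans (+-monoʳ-≤ (suc k) (𝟙≤1 l (suc k))) (≤-reflexive (+-comm (suc k) 1)))
    = refl

  prefixCoeff-side : ∀ m k l →
    coeff (suc m) k 0 l ℤ.+ prefixCoeff m (suc k) 0 l ≡ prefixCoeff (suc m) (suc k) 0 l
  prefixCoeff-side m k l = begin
    coeff (suc m) k 0 l ℤ.+ D x m (suc (k + 0 + e)) (suc k)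
      ≡⟨ cong₂ ℤ._+_ (D-cong (suc m) k (+-identityʳ x) y≡) (D-congʳ x m (suc k) (cong suc y≡)) ⟩
    D x (suc m) y k ℤ.+ D x m (suc y) (suc k)
      ≡⟨ ℤ.+-comm (D x (suc m) y k) (D x m (suc y) (suc k)) ⟩
    D x m (suc y) (suc k) ℤ.+ D x (suc m) y k
      ≡⟨ cong (λ a → D x m (suc y) (suc k) ℤ.+ a) (D-side x (suc m) k l) ⟩
    D x m (suc y) (suc k) ℤ.+ D x (suc m) (suc y) (suc k)
      ≡⟨ D-pascalˡ x m (suc y) (suc k) ⟨
    D (suc x) (suc m) (suc y) (suc k)
      ≡⟨ D-congʳ (suc x) (suc m) (suc k) (cong suc y≡) ⟨
    D (suc x) (suc m) (suc (k + 0 + e)) (suc k) ∎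
    where
    open ≡-Reasoning
    e = 𝟙 l (suc k)
    x = suc (m + l)
    y = k + e
    y≡ : k + 0 + e ≡ y
    y≡ = cong (_+ e) (+-identityʳ k)

  -- At width one the left lower index is 0 and Pascal's rule on the left fails. Instead the second
  -- right factor vanishes, while C(·, 0) = 1 makes the first product insensitive to the left upper
  -- argument.
  prefixCoeff-origin : ∀ k l → coeff 0 k 0 l ≡ prefixCoeff 0 (suc k) 0 l
  prefixCoeff-origin k zero    = trans (coeff-zero 0 k 0 z<s) (sym (trans
    (D-sym 1 0 (suc k + 0 + 0) (suc k))
    (D-vanishˡ 1 0 (≤-reflexive (trans (+-identityʳ (suc k + 0)) (+-identityʳ (suc k)))))))
  prefixCoeff-origin k (suc l) = begin
    coeff 0 k 0 (suc l)
      ≡⟨ D-cong 0 k (+-identityʳ (suc l)) y≡ ⟩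
    D (suc l) 0 y k
      ≡⟨ cong (λ a → + 1 ℤ.* + predC y k ℤ.- + (l C 1) ℤ.* + a) y-zero ⟩
    + 1 ℤ.* + predC y k ℤ.- + (l C 1) ℤ.* 0ℤ
      ≡⟨ cong (ℤ._-_ (+ 1 ℤ.* + predC y k))
           (trans (ℤ.*-zeroʳ (+ (l C 1))) (sym (ℤ.*-zeroʳ (+ (suc l C 1))))) ⟩
    + 1 ℤ.* + predC y k ℤ.- + (suc l C 1) ℤ.* 0ℤ
      ≡⟨ cong (λ a → + 1 ℤ.* + predC y k ℤ.- + (suc l C 1) ℤ.* + a) y-zero ⟨
    D (suc (suc l)) 0 y k
      ≡⟨ D-side (suc (suc l)) 0 k (suc l) ⟩
    D (suc (suc l)) 0 (suc y) (suc k)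
      ≡⟨ D-congʳ (suc (suc l)) 0 (suc k) (cong suc y≡) ⟨
    prefixCoeff 0 (suc k) 0 (suc l) ∎
    where
    open ≡-Reasoning
    e = 𝟙 (suc l) (suc k)
    y = k + e
    y≡ : k + 0 + e ≡ y
    y≡ = cong (_+ e) (+-identityʳ k)
    y-zero : predC y (suc k) ≡ 0
    y-zero = predC-zero (≤-trans (+-monoʳ-≤ k (𝟙≤1 (suc l) (suc k))) (≤-reflexive (+-comm k 1)))

  -- The start of the recursion: at k = 0 the closed form is no prefix sum, but its value 1 is the
  -- weight that a bottom row requires.
  prefixCoeff-0 : ∀ m j → prefixCoeff m 0 j 0 ≡ 1ℤ
  prefixCoeff-0 m j rewrite +-comm j 1 | +-identityʳ m | nCn≡1 m | predC-zero {suc m} {suc m} ≤-refl = refl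

  D≡binom : ∀ x m y k → D (suc x) m (suc y) k ≡
    binom (+ x) (+ m) ℤ.* binom (+ y) (+ k) ℤ.- binom (+ x) (+ suc m) ℤ.* binom (+ y) (+ suc k)
  D≡binom x m y k = cong₂ ℤ._-_ (cong₂ ℤ._*_ (sym (binom≡C x m)) (sym (binom≡C y k)))
    (cong₂ ℤ._*_ (sym (binom≡C x (suc m))) (sym (binom≡C y (suc k))))

  -- Comparison with the integer binomials of the theorem.

  δ≡𝟙 : ∀ r s → δ r s ≡ + 𝟙 r s
  δ≡𝟙 r s with r ≟ s
  ... | yes refl rewrite dec-true (r ≟ r) refl = refl
  ... | no r≢s rewrite dec-false (r ≟ s) r≢s = refl

  upper≡ : ∀ m l j → + suc m ℤ.+ + l ℤ.- + 2 ℤ.+ δ j (suc m) ≡ + (m + l + 𝟙 j (suc m)) ℤ.- + 1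
  upper≡ m l j = trans (cong (λ d → + suc m ℤ.+ + l ℤ.- + 2 ℤ.+ d) (δ≡𝟙 j (suc m)))
    (lemma (+ m) (+ l) (+ 𝟙 j (suc m)))
    where
    lemma : ∀ m l d → 1ℤ ℤ.+ m ℤ.+ l ℤ.- + 2 ℤ.+ d ≡ m ℤ.+ l ℤ.+ d ℤ.- + 1
    lemma = solve-∀

  -- The integer upper index is this sum minus 1, so the case where it is -1 has to be isolated;
  -- otherwise `predC` is the ordinary binomial.
  upper-cases : ∀ m l j → j ≤ suc m →
    (m ≡ 0 × l ≡ 0 × j ≡ 0) ⊎ ∃ λ x → m + l + 𝟙 j (suc m) ≡ suc x
  upper-cases (suc m) l       j             _ = inj₂ (_ , refl)
  upper-cases zero    (suc l) j             _ = inj₂ (_ , refl)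
  upper-cases zero    zero    zero          _ = inj₁ (refl , refl , refl)
  upper-cases zero    zero    (suc zero)    _ = inj₂ (0 , refl)
  upper-cases zero    zero    (suc (suc j)) (s≤s ())

  binomial-difference : ℤ → ℕ → ℤ → ℕ → ℤ
  binomial-difference u m v k =
    binom u (+ m) ℤ.* binom v (+ k) ℤ.- binom u (+ suc m) ℤ.* binom v (+ suc k)

  -- With upper index -1 the binomial coefficients do not vanish, but then the
  -- two products cancel.
  binomial-difference-minus1 : ∀ k → binomial-difference (+ 0 ℤ.- + 1) 0 (+ k ℤ.- + 1) k ≡ 0ℤ
  binomial-difference-minus1 zero    = refl
  binomial-difference-minus1 (suc k) rewrite binom≡C k (suc k) | binom≡C k (suc (suc k))
    | predC-zero {suc k} {suc k} ≤-refl | predC-zero {suc k} {suc (suc k)} (n≤1+n (suc k)) = refl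

  binomial-difference-sym : ∀ u m v k → binomial-difference u m v k ≡ binomial-difference v k u m
  binomial-difference-sym u m v k =
    cong₂ ℤ._-_ (ℤ.*-comm (binom u (+ m)) _) (ℤ.*-comm (binom u (+ suc m)) _)

  coeff≡binom : ∀ m k j l → j ≤ suc m → l ≤ suc k →
    coeff m k j l ≡
      binom (+ suc m ℤ.+ + l ℤ.- + 2 ℤ.+ δ j (suc m)) (+ suc m ℤ.- + 1)
        ℤ.* binom (+ suc k ℤ.+ + j ℤ.- + 2 ℤ.+ δ l (suc k)) (+ suc k ℤ.- + 1)
      ℤ.- binom (+ suc m ℤ.+ + l ℤ.- + 2 ℤ.+ δ j (suc m)) (+ suc m)
        ℤ.* binom (+ suc k ℤ.+ + j ℤ.- + 2 ℤ.+ δ l (suc k)) (+ suc k)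
  coeff≡binom m k j l j≤m l≤k = trans (via (upper-cases m l j j≤m) (upper-cases k j l l≤k))
    (cong₂ (λ u v → binomial-difference u m v k) (sym (upper≡ m l j)) (sym (upper≡ k j l)))
    where
    via : (m ≡ 0 × l ≡ 0 × j ≡ 0) ⊎ (∃ λ x → m + l + 𝟙 j (suc m) ≡ suc x) →
          (k ≡ 0 × j ≡ 0 × l ≡ 0) ⊎ (∃ λ y → k + j + 𝟙 l (suc k) ≡ suc y) →
          coeff m k j l ≡
            binomial-difference (+ (m + l + 𝟙 j (suc m)) ℤ.- + 1) m (+ (k + j + 𝟙 l (suc k)) ℤ.- + 1) k
    via (inj₁ (refl , refl , refl)) _ = sym (trans
      (cong (λ b → binomial-difference (+ 0 ℤ.- + 1) 0 (+ b ℤ.- + 1) k) (trans (+-identityʳ (k + 0)) (+-identityʳ k)))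
      (binomial-difference-minus1 k))
    -- Only the right upper index is known to be -1 here; exchanging the two pairs reduces this to
    -- the preceding situation.
    via (inj₂ _) (inj₁ (refl , refl , refl)) = trans
      (cong₂ ℤ._-_ (ℤ.*-zeroʳ (+ predC (m + 0 + 0) m)) (ℤ.*-zeroʳ (+ predC (m + 0 + 0) (suc m))))
      (sym (trans
        (cong (λ a → binomial-difference (+ a ℤ.- + 1) m (+ 0 ℤ.- + 1) 0) (trans (+-identityʳ (m + 0)) (+-identityʳ m)))
        (trans (binomial-difference-sym (+ m ℤ.- + 1) m (+ 0 ℤ.- + 1) 0) (binomial-difference-minus1 m))))
    via (inj₂ (x , a≡)) (inj₂ (y , b≡)) rewrite a≡ | b≡ = D≡binom x m y k

-- A row-by-row Boolean criterion for condensed Catalan fillings.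

module Rows where

  open import Data.Bool.Base using (Bool; true; false; T; not; _∧_; _∨_; if_then_else_)
  open import Data.Fin.Base as Fin using (Fin; zero; suc; toℕ)
  open import Data.Nat.Base
  open import Data.Nat.Properties
  open import Data.Product.Base using (Σ-syntax; ∃; ∃-syntax; _×_; _,_)
  open import Data.Sum.Base using (_⊎_; inj₁; inj₂)
  open import Data.Vec.Base as Vec using (Vec; []; _∷_)
  open import Data.Vec.Relation.Unary.All as All using (All; []; _∷_)
  open import Function.Base using (_∘_)
  open import Function.Bundles using (_⇔_; mk⇔)
  open import Relation.Binary.PropositionalEquality
  open import Relation.Nullary using (¬_; contradiction)

  isα isβ isEmpty : Cell → Bool
  isα αᶜ = true
  isα _  = false
  isβ βᶜ = true
  isβ _  = false
  isEmpty empty = true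
  isEmpty _     = false

  hasβ : ∀ {p} → Vec Cell p → Bool
  hasβ []      = false
  hasβ (x ∷ w) = isβ x ∨ hasβ w

  -- Columns are natural numbers, not elements of `Fin`, so that rows of different lengths can be
  -- compared; beyond its end a row carries no α.
  αAt : ∀ {p} → Vec Cell p → ℕ → Bool
  αAt []      _       = false
  αAt (x ∷ w) zero    = isα x
  αAt (x ∷ w) (suc c) = αAt w c

  blocked : ∀ {k} {μ : Vec ℕ k} → Filling μ → ℕ → Bool
  blocked []      c = false
  blocked (w ∷ T) c = αAt w c ∨ blocked T c

  cellOK : Bool → Cell → Bool
  cellOK true  x = isEmpty x
  cellOK false x = not (isEmpty x)

  -- b marks the columns containing an α in some lower row.
  rowOK : ∀ {p} → (ℕ → Bool) → Vec Cell p → Bool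
  rowOK b []      = true
  rowOK b (x ∷ w) = rowOK (b ∘ suc) w ∧ cellOK (b 0 ∨ hasβ w) x

  freeCount : (ℕ → Bool) → ℕ → ℕ
  freeCount b zero    = 0
  freeCount b (suc p) = (if b 0 then 0 else 1) + freeCount (b ∘ suc) p

  freeAfter : ∀ {p} → (ℕ → Bool) → Vec Cell p → ℕ
  freeAfter {p} b w = freeCount (λ c → αAt w c ∨ b c) p

  -- Read from the right, every free column receives α, and so ceases to be free, until the β is
  -- placed; the column of the β itself stays free.
  hasβ≡0<freeAfter : ∀ {p} b (w : Vec Cell p) → T (rowOK b w) → hasβ w ≡ (0 <ᵇ freeAfter b w)
  hasβ≡0<freeAfter b []      _  = refl
  hasβ≡0<freeAfter b (x ∷ w) ok with rowOK (b ∘ suc) w in okʷ | b 0 | hasβ w in β∈w | x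
  ... | true | true  | _     | empty = trans (sym β∈w) (hasβ≡0<freeAfter (b ∘ suc) w (subst T (sym okʷ) _))
  ... | true | false | true  | empty = refl
  ... | true | false | false | αᶜ    = trans (sym β∈w) (hasβ≡0<freeAfter (b ∘ suc) w (subst T (sym okʷ) _))
  ... | true | false | false | βᶜ    = refl

  module _ {p} (b : ℕ → Bool) (w : Vec Cell p) where

    RowCondition : Set
    RowCondition =
      (∀ (c c′ : Fin p) → c′ Fin.< c → Vec.lookup w c ≡ βᶜ → Vec.lookup w c′ ≡ empty) ×
      (∀ c → T (b (toℕ c)) → Vec.lookup w c ≡ empty) ×
      (∀ c → ¬ T (b (toℕ c)) → ¬ (∃[ c′ ] (c Fin.< c′ × Vec.lookup w c′ ≡ βᶜ)) →
         Vec.lookup w c ≡ αᶜ ⊎ Vec.lookup w c ≡ βᶜ)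

  hasβ⁺ : ∀ {p} (w : Vec Cell p) c → Vec.lookup w c ≡ βᶜ → T (hasβ w)
  hasβ⁺ (βᶜ ∷ w)    _       _  = _
  hasβ⁺ (αᶜ ∷ w)    (suc c) eq = hasβ⁺ w c eq
  hasβ⁺ (empty ∷ w) (suc c) eq = hasβ⁺ w c eq

  hasβ⁻ : ∀ {p} (w : Vec Cell p) → T (hasβ w) → ∃ λ c → Vec.lookup w c ≡ βᶜ
  hasβ⁻ (βᶜ ∷ w)    _ = zero , refl
  hasβ⁻ (αᶜ ∷ w)    h = let c , eq = hasβ⁻ w h in suc c , eq
  hasβ⁻ (empty ∷ w) h = let c , eq = hasβ⁻ w h in suc c , eq

  T-∨ˡ : ∀ {x} y → T x → T (x ∨ y)
  T-∨ˡ {true} _ _ = _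

  T-∨ʳ : ∀ x {y} → T y → T (x ∨ y)
  T-∨ʳ true  _ = _
  T-∨ʳ false t = t

  ¬T-∨ : ∀ x {y} → ¬ T x → ¬ T y → ¬ T (x ∨ y)
  ¬T-∨ true  ¬x _  = ¬x
  ¬T-∨ false _  ¬y = ¬y

  T-∧⁻ : ∀ x {y} → T (x ∧ y) → T x × T y
  T-∧⁻ true t = _ , t

  T-∧⁺ : ∀ {x y} → T x → T y → T (x ∧ y)
  T-∧⁺ {true} _ t = t

  cellOK-empty : ∀ b x → T b → T (cellOK b x) → x ≡ empty
  cellOK-empty true empty _ _ = refl

  cellOK-nonempty : ∀ b x → ¬ T b → T (cellOK b x) → x ≡ αᶜ ⊎ x ≡ βᶜ
  cellOK-nonempty true  x     ¬b _ = contradiction _ ¬b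
  cellOK-nonempty false αᶜ    _  _ = inj₁ refl
  cellOK-nonempty false βᶜ    _  _ = inj₂ refl

  cellOK⁺ : ∀ b x → (T b → x ≡ empty) → (¬ T b → x ≡ αᶜ ⊎ x ≡ βᶜ) → T (cellOK b x)
  cellOK⁺ true  x e _ rewrite e _ = _
  cellOK⁺ false x _ f with f (λ ())
  ... | inj₁ refl = _
  ... | inj₂ refl = _

  T-∨⁻ : ∀ x {y} → T (x ∨ y) → T x ⊎ T y
  T-∨⁻ true  _ = inj₁ _
  T-∨⁻ false t = inj₂ t

  rowOK⇒RowCondition : ∀ {p} b (w : Vec Cell p) → T (rowOK b w) → RowCondition b w
  rowOK⇒RowCondition b []      _  = (λ ()) , (λ ()) , (λ ())
  rowOK⇒RowCondition b (x ∷ w) ok =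
    let okʷ , okˣ = T-∧⁻ (rowOK (b ∘ suc) w) ok
        left , above , free = rowOK⇒RowCondition (b ∘ suc) w okʷ
    in
    (λ where
      (suc c) (suc c′) (s≤s lt) eq → left c c′ lt eq
      (suc c) zero     _        eq → cellOK-empty _ x (T-∨ʳ (b 0) (hasβ⁺ w c eq)) okˣ) ,
    (λ where
      (suc c) t → above c t
      zero    t → cellOK-empty _ x (T-∨ˡ _ t) okˣ) ,
    (λ where
      (suc c) ¬t ¬β → free c ¬t (λ (c′ , lt , eq) → ¬β (suc c′ , s≤s lt , eq))
      zero    ¬t ¬β → cellOK-nonempty _ x
        (¬T-∨ (b 0) ¬t (λ h → let c′ , eq = hasβ⁻ w h in ¬β (suc c′ , s≤s z≤n , eq))) okˣ)

  RowCondition⇒rowOK : ∀ {p} b (w : Vec Cell p) → RowCondition b w → T (rowOK b w)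
  RowCondition⇒rowOK b []      _                     = _
  RowCondition⇒rowOK b (x ∷ w) (left , above , free) = T-∧⁺
    (RowCondition⇒rowOK (b ∘ suc) w
      ( (λ c c′ lt → left (suc c) (suc c′) (s≤s lt))
      , (λ c → above (suc c))
      , (λ c ¬t ¬β → free (suc c) ¬t λ where (suc c′ , s≤s lt , eq) → ¬β (c′ , lt , eq))))
    (cellOK⁺ (b 0 ∨ hasβ w) x
      (λ t → case-∨ (T-∨⁻ (b 0) t))
      (λ ¬t → free zero (λ t → ¬t (T-∨ˡ _ t)) λ where
        (suc c′ , _ , eq) → ¬t (T-∨ʳ (b 0) (hasβ⁺ w c′ eq))))
    where
    case-∨ : T (b 0) ⊎ T (hasβ w) → x ≡ empty
    case-∨ (inj₁ t) = above zero t
    case-∨ (inj₂ h) = let c , eq = hasβ⁻ w h in left (suc c) zero (s≤s z≤n) eq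

  αAt⁺ : ∀ {p} (w : Vec Cell p) c → Vec.lookup w c ≡ αᶜ → T (αAt w (toℕ c))
  αAt⁺ (αᶜ ∷ w) zero    _  = _
  αAt⁺ (x ∷ w)  (suc c) eq = αAt⁺ w c eq

  αAt⁻ : ∀ {p} (w : Vec Cell p) c → T (αAt w c) → Σ[ c′ ∈ Fin p ] (toℕ c′ ≡ c × Vec.lookup w c′ ≡ αᶜ)
  αAt⁻ (αᶜ ∷ w) zero    _ = zero , refl , refl
  αAt⁻ (x ∷ w)  (suc c) t = let c′ , eq , α = αAt⁻ w c t in suc c′ , cong suc eq , α

  blocked⁺ : ∀ {k} {μ : Vec ℕ k} (T′ : Filling μ) r (c : Col T′ r) → entry T′ r c ≡ αᶜ → T (blocked T′ (toℕ c))
  blocked⁺ (w ∷ T′) zero    c eq = T-∨ˡ _ (αAt⁺ w c eq)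
  blocked⁺ (w ∷ T′) (suc r) c eq = T-∨ʳ (αAt w (toℕ c)) (blocked⁺ T′ r c eq)

  blocked⁻ : ∀ {k} {μ : Vec ℕ k} (T′ : Filling μ) c → T (blocked T′ c) →
    ∃[ r ] Σ[ c′ ∈ Col T′ r ] (toℕ c′ ≡ c × entry T′ r c′ ≡ αᶜ)
  blocked⁻ (w ∷ T′) c t with T-∨⁻ (αAt w c) t
  ... | inj₁ t′ = zero , αAt⁻ w c t′
  ... | inj₂ t′ = let r , rest = blocked⁻ T′ c t′ in suc r , rest

  -- No condition on the lower rows refers to the new top row, once the rule about boxes above an α
  -- is read from the upper box. The top row in turn sees the rows below only through `blocked`.
  isCondensedCatalan-∷ : ∀ {k p} {μ : Vec ℕ k} (w : Vec Cell p) (T′ : Filling μ) →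
    IsCondensedCatalan {μ = p ∷ μ} (w ∷ T′) ⇔ (IsCondensedCatalan T′ × T (rowOK (blocked T′) w))
  isCondensedCatalan-∷ {p = p} {μ} w T′ = mk⇔ to from
    where
    to : IsCondensedCatalan {μ = p ∷ μ} (w ∷ T′) → IsCondensedCatalan T′ × T (rowOK (blocked T′) w)
    to (left , above , free) =
      ( (λ r → left (suc r))
      , (λ r r′ c c′ lt → above (suc r) (suc r′) c c′ (s≤s lt))
      , (λ r c ¬α → free (suc r) c λ where (suc r′ , c′ , s≤s lt , eqs) → ¬α (r′ , c′ , lt , eqs))) ,
      RowCondition⇒rowOK (blocked T′) w
        ( left zero
        , (λ c t →
            let r , c′ , eq , α = blocked⁻ T′ (toℕ c) t in above (suc r) zero c′ c (s≤s z≤n) (sym eq) α)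
        , (λ c ¬t → free zero c λ where
            (suc r , c′ , _ , eq , α) → ¬t (subst (T ∘ blocked T′) eq (blocked⁺ T′ r c′ α))))
    from : IsCondensedCatalan T′ × T (rowOK (blocked T′) w) → IsCondensedCatalan {μ = p ∷ μ} (w ∷ T′)
    from ((left , above , free) , ok) with rowOK⇒RowCondition (blocked T′) w ok
    ... | leftʷ , aboveʷ , freeʷ =
      (λ where
        zero    → leftʷ
        (suc r) → left r) ,
      (λ where
        (suc r) (suc r′) c c′ (s≤s lt) → above r r′ c c′ lt
        (suc r) zero     c c′ _ eq α   → aboveʷ c′ (subst (T ∘ blocked T′) (sym eq) (blocked⁺ T′ r c α))) ,
      (λ where
        zero    c ¬α → freeʷ c (λ t →
          let r , c′ , eq , α = blocked⁻ T′ (toℕ c) t in ¬α (suc r , c′ , s≤s z≤n , eq , α))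
        (suc r) c ¬α → free r c (λ (r′ , c′ , lt , eqs) → ¬α (suc r′ , c′ , s≤s lt , eqs)))

  αAt-beyond : ∀ {p} (w : Vec Cell p) {c} → p ≤ c → αAt w c ≡ false
  αAt-beyond []      _         = refl
  αAt-beyond (x ∷ w) (s≤s p≤c) = αAt-beyond w p≤c

  blocked-beyond : ∀ {k q c} {μ : Vec ℕ k} (T′ : Filling μ) → All (_≤ q) μ → q ≤ c → blocked T′ c ≡ false
  blocked-beyond []       []           _   = refl
  blocked-beyond (w ∷ T′) (p≤q ∷ μ≤q) q≤c
    rewrite αAt-beyond w (≤-trans p≤q q≤c) = blocked-beyond T′ μ≤q q≤c

  freeCount-extend : ∀ b {q p} → q ≤ p → (∀ {c} → q ≤ c → b c ≡ false) →
    freeCount b p ≡ freeCount b q + (p ∸ q)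
  freeCount-extend b {p = zero}  z≤n _ = refl
  freeCount-extend b {p = suc p} z≤n h rewrite h {0} z≤n =
    cong suc (freeCount-extend (b ∘ suc) {p = p} z≤n (λ _ → h z≤n))
  freeCount-extend b {suc q} {suc p} (s≤s q≤p) h =
    trans (cong (λ n → (if b 0 then 0 else 1) + n) (freeCount-extend (b ∘ suc) q≤p (λ q≤c → h (s≤s q≤c))))
      (sym (+-assoc (if b 0 then 0 else 1) _ (p ∸ q)))

module GeneratingFunction {c ℓ} (R : CommutativeRing c ℓ) where

  open Coefficients
  open Rows

  open import Data.Bool.Base using (Bool; true; false; if_then_else_)
  open import Data.Fin.Base using (toℕ)
  open import Data.Fin.Properties using (toℕ<n)
  open import Data.Integer.Base as ℤ using (ℤ; -[1+_]; 0ℤ)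
  import Data.Integer.Properties as ℤ
  open import Data.List.Base as List using (List; []; _∷_; foldr; _++_; filter; concatMap; cartesianProductWith;
    upTo; applyUpTo)
  open import Data.Nat.Base as ℕ using (zero; suc; _≤_; _<_; _≥_; _∸_; z≤n; s≤s)
  import Data.Nat.Properties as ℕ
  open import Data.Product.Base using (_×_; _,_; proj₁)
  open import Data.Vec.Base as Vec using (Vec; []; _∷_)
  open import Data.Vec.Relation.Unary.All using ([]; _∷_)
  open import Data.Vec.Relation.Unary.Linked using (Linked; linked?; _∷_)
  open import Data.Vec.Relation.Unary.Linked.Properties using (Linked⇒All)
  open import Function.Base using (_∘_)
  open import Function.Bundles using (_⇔_; mk⇔)
  open import Relation.Binary.PropositionalEquality as ≡ using (_≡_; _≢_)
  open import Relation.Nullary using (Dec; does; yes; no)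
  open import Relation.Nullary.Decidable using (does-⇔; dec-true; dec-false; T?; _×-dec_)
  open import Relation.Unary using (Decidable; Pred)

  open CommutativeRing R
  open Over R
  open import Algebra.Properties.Monoid.Mult +-monoid using (×-homo-+) renaming (_×_ to _·_)
  open import Algebra.Properties.Ring ring using (+-cancelʳ; -‿+-comm; -0#≈0#)
  open import Algebra.Properties.Semiring.Exp semiring using (^-homo-*)
  open import Algebra.Properties.Semiring.Sum semiring using (sum-cong-≋; ∑-distrib-+; ∑-comm; *-distribˡ-sum)
  open import Algebra.Solver.Ring.NaturalCoefficients.Default commutativeSemiring using (solve; _:=_; _:+_; _:*_; con)
  open import Relation.Binary.Reasoning.Setoid setoid

  -- Integers in the ring, finite sums and conditional summands.

  fromℤ-⊖ : ∀ m n → fromℤ (m ℤ.⊖ n) ≈ m · 1# - n · 1#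
  fromℤ-⊖ m       zero    = sym (trans (+-congˡ -0#≈0#) (+-identityʳ _))
  fromℤ-⊖ zero    (suc n) = sym (+-identityˡ _)
  fromℤ-⊖ (suc m) (suc n) = begin
    fromℤ (suc m ℤ.⊖ suc n)           ≡⟨ ≡.cong fromℤ (ℤ.[1+m]⊖[1+n]≡m⊖n m n) ⟩
    fromℤ (m ℤ.⊖ n)                   ≈⟨ fromℤ-⊖ m n ⟩
    m · 1# - n · 1#                   ≈⟨ +-identityˡ _ ⟨
    0# + (m · 1# - n · 1#)            ≈⟨ +-congʳ (-‿inverseʳ 1#) ⟨
    1# - 1# + (m · 1# - n · 1#)       ≈⟨ solve 4 (λ a b c d → (a :+ b) :+ (c :+ d) := (a :+ c) :+ (b :+ d)) refl
                                             1# (- 1#) (m · 1#) (- (n · 1#)) ⟩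
    1# + m · 1# + (- 1# - n · 1#)     ≈⟨ +-congˡ (-‿+-comm 1# (n · 1#)) ⟩
    suc m · 1# - suc n · 1#           ∎

  fromℤ-+ : ∀ a b → fromℤ (a ℤ.+ b) ≈ fromℤ a + fromℤ b
  fromℤ-+ (+ m)    (+ n)    = ×-homo-+ 1# m n
  fromℤ-+ (+ m)    -[1+ n ] = fromℤ-⊖ m (suc n)
  fromℤ-+ -[1+ m ] (+ n)    = trans (fromℤ-⊖ n (suc m)) (+-comm _ _)
  fromℤ-+ -[1+ m ] -[1+ n ] = begin
    - (suc (suc (m ℕ.+ n)) · 1#)    ≡⟨ ≡.cong (λ k → - (suc k · 1#)) (ℕ.+-suc m n) ⟨
    - ((suc m ℕ.+ suc n) · 1#)      ≈⟨ -‿cong (×-homo-+ 1# (suc m) (suc n)) ⟩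
    - (suc m · 1# + suc n · 1#)     ≈⟨ -‿+-comm _ _ ⟨
    - (suc m · 1#) - suc n · 1#     ∎

  ∑≤-cong : ∀ n {f g} → (∀ {i} → i ≤ n → f i ≈ g i) → ∑≤ n f ≈ ∑≤ n g
  ∑≤-cong n f≈g = sum-cong-≋ {suc n} (λ i → f≈g (ℕ.≤-pred (toℕ<n i)))

  ∑≤-snoc : ∀ n f → ∑≤ (suc n) f ≈ ∑≤ n f + f (suc n)
  ∑≤-snoc zero    f = trans (+-congˡ (+-identityʳ _)) (+-congʳ (sym (+-identityʳ _)))
  ∑≤-snoc (suc n) f = trans (+-congˡ (∑≤-snoc n (f ∘ suc))) (sym (+-assoc _ _ _))

  ∑≤-+ : ∀ n f g → ∑≤ n (λ i → f i + g i) ≈ ∑≤ n f + ∑≤ n g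
  ∑≤-+ n f g = ∑-distrib-+ {suc n} (f ∘ toℕ) (g ∘ toℕ)

  ∑≤-*ˡ : ∀ n x f → x * ∑≤ n f ≈ ∑≤ n (λ i → x * f i)
  ∑≤-*ˡ n x f = *-distribˡ-sum {suc n} x (f ∘ toℕ)

  listSum : ∀ {a} {A : Set a} → (A → Carrier) → List A → Carrier
  listSum f xs = foldr _+_ 0# (List.map f xs)

  -- Only the Boolean of the decision enters, so equivalent propositions can be exchanged whatever
  -- their decision procedures.
  when : ∀ {a} {P : Set a} → Dec P → Carrier → Carrier
  when P? x = if does P? then x else 0#

  when-cong : ∀ {a} {P : Set a} (P? : Dec P) {x y} → (P → x ≈ y) → when P? x ≈ when P? y
  when-cong (yes p) x≈y = x≈y p
  when-cong (no ¬p) x≈y = refl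

  when-⇔ : ∀ {a b} {P : Set a} {Q : Set b} → P ⇔ Q →
    (P? : Dec P) (Q? : Dec Q) → ∀ x → when P? x ≈ when Q? x
  when-⇔ P⇔Q P? Q? x = reflexive (≡.cong (if_then x else 0#) (does-⇔ P⇔Q P? Q?))

  when-× : ∀ {a b} {P : Set a} {Q : Set b} (P? : Dec P) (Q? : Dec Q) x →
    when (P? ×-dec Q?) x ≈ when P? (when Q? x)
  when-× (yes _) Q? x = refl
  when-× (no _)  Q? x = refl

  when-* : ∀ {a} {P : Set a} (P? : Dec P) x y → x * when P? y ≈ when P? (x * y)
  when-* (yes _) x y = refl
  when-* (no _)  x y = zeroʳ x

  module _ {a} {A : Set a} where

    listSum-cong : ∀ {f g : A → Carrier} → (∀ x → f x ≈ g x) → ∀ xs → listSum f xs ≈ listSum g xs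
    listSum-cong f≈g []       = refl
    listSum-cong f≈g (x ∷ xs) = +-cong (f≈g x) (listSum-cong f≈g xs)

    listSum-++ : ∀ (f : A → Carrier) xs ys → listSum f (xs ++ ys) ≈ listSum f xs + listSum f ys
    listSum-++ f []       ys = sym (+-identityˡ _)
    listSum-++ f (x ∷ xs) ys = trans (+-congˡ (listSum-++ f xs ys)) (sym (+-assoc _ _ _))

    listSum-0 : ∀ xs → listSum {A = A} (λ _ → 0#) xs ≈ 0#
    listSum-0 []       = refl
    listSum-0 (x ∷ xs) = trans (+-identityˡ _) (listSum-0 xs)

    listSum-+ : ∀ (f g : A → Carrier) xs → listSum f xs + listSum g xs ≈ listSum (λ x → f x + g x) xs
    listSum-+ f g []       = +-identityʳ 0#
    listSum-+ f g (x ∷ xs) = trans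
      (solve 4 (λ a b c d → (a :+ b) :+ (c :+ d) := (a :+ c) :+ (b :+ d)) refl _ _ _ _)
      (+-congˡ (listSum-+ f g xs))

    listSum-*ˡ : ∀ y (f : A → Carrier) xs → y * listSum f xs ≈ listSum (λ x → y * f x) xs
    listSum-*ˡ y f []       = zeroʳ y
    listSum-*ˡ y f (x ∷ xs) = trans (distribˡ _ _ _) (+-congˡ (listSum-*ˡ y f xs))

    listSum-when : ∀ {b} {P : Set b} (P? : Dec P) (f : A → Carrier) xs →
      listSum (λ x → when P? (f x)) xs ≈ when P? (listSum f xs)
    listSum-when (yes _) f xs = refl
    listSum-when (no _)  f xs = listSum-0 xs

    listSum-filter : ∀ {b} {P : Pred A b} (P? : Decidable P) (f : A → Carrier) xs →
      listSum f (filter P? xs) ≈ listSum (λ x → when (P? x) (f x)) xs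
    listSum-filter P? f []       = refl
    listSum-filter P? f (x ∷ xs) with does (P? x)
    ... | true  = +-congˡ (listSum-filter P? f xs)
    ... | false = trans (listSum-filter P? f xs) (sym (+-identityˡ _))

  module _ {a b} {A : Set a} {B : Set b} where

    listSum-map : ∀ (f : B → Carrier) (g : A → B) xs → listSum f (List.map g xs) ≡ listSum (f ∘ g) xs
    listSum-map f g []       = ≡.refl
    listSum-map f g (x ∷ xs) = ≡.cong (λ s → f (g x) + s) (listSum-map f g xs)

    listSum-concatMap : ∀ (f : B → Carrier) (g : A → List B) xs →
      listSum f (concatMap g xs) ≈ listSum (λ x → listSum f (g x)) xs
    listSum-concatMap f g []       = refl
    listSum-concatMap f g (x ∷ xs) =
      trans (listSum-++ f (g x) (concatMap g xs)) (+-congˡ (listSum-concatMap f g xs))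

    listSum-swap : ∀ (f : A → B → Carrier) xs ys →
      listSum (λ x → listSum (f x) ys) xs ≈ listSum (λ y → listSum (λ x → f x y) xs) ys
    listSum-swap f []       ys = sym (listSum-0 ys)
    listSum-swap f (x ∷ xs) ys = trans (+-congˡ (listSum-swap f xs ys)) (listSum-+ (f x) _ ys)

  listSum-cartesianProductWith : ∀ {a b d} {A : Set a} {B : Set b} {D : Set d}
    (f : D → Carrier) (g : A → B → D) xs ys →
    listSum f (cartesianProductWith g xs ys) ≈ listSum (λ x → listSum (λ y → f (g x y)) ys) xs
  listSum-cartesianProductWith f g []       ys = refl
  listSum-cartesianProductWith f g (x ∷ xs) ys = trans
    (listSum-++ f (List.map (g x) ys) _)
    (+-cong (reflexive (listSum-map f (g x) ys)) (listSum-cartesianProductWith f g xs ys))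

  listSum-applyUpTo : ∀ (f : ℕ → Carrier) (g : ℕ → ℕ) n → listSum f (applyUpTo g (suc n)) ≈ ∑≤ n (f ∘ g)
  listSum-applyUpTo f g zero    = refl
  listSum-applyUpTo f g (suc n) = +-congˡ (listSum-applyUpTo f (g ∘ suc) n)

  ∑≤-0 : ∀ n → ∑≤ n (λ _ → 0#) ≈ 0#
  ∑≤-0 zero    = +-identityʳ 0#
  ∑≤-0 (suc n) = trans (+-identityˡ _) (∑≤-0 n)

  ∑≤-truncate : ∀ n p (f : ℕ → Carrier) → p ≤ n → ∑≤ n (λ q → when (q ℕ.≤? p) (f q)) ≈ ∑≤ p f
  ∑≤-truncate zero    zero    f _ = refl
  ∑≤-truncate (suc n) zero    f _ = +-congˡ (∑≤-0 n)
  ∑≤-truncate (suc n) (suc p) f (s≤s p≤n) = +-congˡ (trans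
    (∑≤-cong n (λ {q} _ → when-⇔ (mk⇔ ℕ.≤-pred s≤s) (suc q ℕ.≤? suc p) (q ℕ.≤? p) (f (suc q))))
    (∑≤-truncate n p (f ∘ suc) p≤n))

  ∑≤-pick : ∀ n (f : ℕ → Carrier) → ∑≤ n (λ q → when (q ℕ.≟ n) (f q)) ≈ f n
  ∑≤-pick zero    f = +-identityʳ _
  ∑≤-pick (suc n) f = trans (+-identityˡ _) (∑≤-pick n (f ∘ suc))

  ∑≤-swap : ∀ m n (f : ℕ → ℕ → Carrier) → ∑≤ m (λ i → ∑≤ n (f i)) ≈ ∑≤ n (λ j → ∑≤ m (λ i → f i j))
  ∑≤-swap m n f = ∑-comm {suc m} {suc n} (λ i j → f (toℕ i) (toℕ j))

  -- Row operators on functions of the number of free columns.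

  module _ (α β : Carrier) where

    -- Z m s φ = Σ_{j<m} α^j s_j β φ_{m-j} + α^m s_m φ_0.  The case s = 1, E f φ,
    -- sums over the fillings of a row with f free columns: j of them receive α,
    -- β follows unless none is left, and f - j remain.
    Z : ℕ → (ℕ → Carrier) → (ℕ → Carrier) → Carrier
    Z zero    s φ = s 0 * φ 0
    Z (suc m) s φ = s 0 * (β * φ (suc m)) + α * Z m (s ∘ suc) φ

    E : ℕ → (ℕ → Carrier) → Carrier
    E m = Z m (λ _ → 1#)

    Z-cong : ∀ m {s t φ ψ} → (∀ {j} → j ≤ m → s j ≈ t j) → (∀ {f} → f ≤ m → φ f ≈ ψ f) → Z m s φ ≈ Z m t ψ
    Z-cong zero    s≈t φ≈ψ = *-cong (s≈t z≤n) (φ≈ψ z≤n)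
    Z-cong (suc m) s≈t φ≈ψ = +-cong (*-cong (s≈t z≤n) (*-congˡ (φ≈ψ ℕ.≤-refl)))
      (*-congˡ (Z-cong m (s≈t ∘ s≤s) (φ≈ψ ∘ ℕ.m≤n⇒m≤1+n)))

    Z-+ : ∀ m s t φ → Z m s φ + Z m t φ ≈ Z m (λ j → s j + t j) φ
    Z-+ zero    s t φ = sym (distribʳ _ _ _)
    Z-+ (suc m) s t φ = trans
      (solve 6 (λ s t x a y z → (s :* x :+ a :* y) :+ (t :* x :+ a :* z) := (s :+ t) :* x :+ a :* (y :+ z)) refl
        (s 0) (t 0) (β * φ (suc m)) α (Z m (s ∘ suc) φ) (Z m (t ∘ suc) φ))
      (+-congˡ (*-congˡ (Z-+ m (s ∘ suc) (t ∘ suc) φ)))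

    Z-* : ∀ m x s φ → x * Z m s φ ≈ Z m (λ j → x * s j) φ
    Z-* zero    x s φ = sym (*-assoc _ _ _)
    Z-* (suc m) x s φ = trans
      (solve 5 (λ x s y a z → x :* (s :* y :+ a :* z) := (x :* s) :* y :+ a :* (x :* z)) refl
        x (s 0) (β * φ (suc m)) α (Z m (s ∘ suc) φ))
      (+-congˡ (*-congˡ (Z-* m x (s ∘ suc) φ)))

    -- The effect of one more free column at the left end. If no column to its right is left free,
    -- there is no β yet and the new cell is α or β; otherwise it lies left of a β, is empty and
    -- stays free.
    widen : (ℕ → Carrier) → ℕ → Carrier
    widen φ zero    = α * φ 0 + β * φ 1
    widen φ (suc f) = φ (suc (suc f))

    -- Only the last term, with `widen φ 0`, splits in two. They become the terms j = m and j = m +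
    -- 1, both with coefficient `s m`; hence the minimum.
    Z-widen : ∀ m s φ → Z m s (widen φ) ≈ Z (suc m) (λ j → s (j ℕ.⊓ m)) φ
    Z-widen zero    s φ = solve 5 (λ s a x b y → s :* (a :* x :+ b :* y) := s :* (b :* y) :+ a :* (s :* x)) refl
      (s 0) α (φ 0) β (φ 1)
    Z-widen (suc m) s φ = +-congˡ (*-congˡ (Z-widen m (s ∘ suc) φ))

    E-widen : ∀ m φ → E m (widen φ) ≈ E (suc m) φ
    E-widen m = Z-widen m (λ _ → 1#)

    -- The factor that `Z` attaches to its j-th term besides the power of α.
    stepWeight : ℕ → ℕ → Carrier
    stepWeight m j = if does (j ℕ.≟ m) then 1# else β

    stepWeight-refl : ∀ m → stepWeight m m ≡ 1#
    stepWeight-refl m = ≡.cong (if_then 1# else β) (dec-true (m ℕ.≟ m) ≡.refl)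

    stepWeight-≢ : ∀ {m j} → j ≢ m → stepWeight m j ≡ β
    stepWeight-≢ {m} {j} j≢m = ≡.cong (if_then 1# else β) (dec-false (j ℕ.≟ m) j≢m)

    prefixSum : ℕ → (ℕ → Carrier) → ℕ → Carrier
    prefixSum m s zero    = stepWeight m 0 * s 0
    prefixSum m s (suc j) = prefixSum m s j + stepWeight m (suc j) * s (suc j)

    prefixSum-suc : ∀ m s j → prefixSum (suc m) s (suc j) ≈ β * s 0 + prefixSum m (s ∘ suc) j
    prefixSum-suc m s zero    = refl
    prefixSum-suc m s (suc j) = trans (+-congʳ (prefixSum-suc m s j)) (+-assoc _ _ _)

    -- A term with i α's is followed by a row with j - i further ones. Collecting by the total j
    -- sums the weighted `s i` over i ≤ j.
    Z-E : ∀ m s φ → Z m s (λ f → E f φ) ≈ Z m (prefixSum m s) φ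
    Z-E zero    s φ = solve 2 (λ s x → s :* (con 1 :* x) := (con 1 :* s) :* x) refl (s 0) (φ 0)
    Z-E (suc m) s φ = begin
      s 0 * (β * (1# * (β * φ (suc m)) + α * E m φ)) + α * Z m (s ∘ suc) (λ f → E f φ)
        ≈⟨ +-congˡ (*-congˡ (Z-E m (s ∘ suc) φ)) ⟩
      s 0 * (β * (1# * (β * φ (suc m)) + α * E m φ)) + α * Z m (prefixSum m (s ∘ suc)) φ
        ≈⟨ solve 6 (λ s b x a e z → s :* (b :* (con 1 :* (b :* x) :+ a :* e)) :+ a :* z :=
                     (b :* s) :* (b :* x) :+ a :* ((b :* s) :* e :+ z)) refl
           (s 0) β (φ (suc m)) α (E m φ) (Z m (prefixSum m (s ∘ suc)) φ) ⟩
      β * s 0 * (β * φ (suc m)) + α * (β * s 0 * E m φ + Z m (prefixSum m (s ∘ suc)) φ)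
        -- A multiple of `E m φ` is `Z` with a constant sequence, which can then be merged with the
        -- tail into one prefix sum.
        ≈⟨ +-congˡ (*-congˡ (+-congʳ (trans (Z-* m (β * s 0) _ φ) (Z-cong m (λ _ → *-identityʳ _) (λ _ → refl))))) ⟩
      β * s 0 * (β * φ (suc m)) + α * (Z m (λ _ → β * s 0) φ + Z m (prefixSum m (s ∘ suc)) φ)
        ≈⟨ +-congˡ (*-congˡ (trans (Z-+ m _ _ φ) (Z-cong m (λ {j} _ → sym (prefixSum-suc m s j)) (λ _ → refl)))) ⟩
      Z (suc m) (prefixSum (suc m) s) φ ∎

    Z-total : ∀ m s → Z m s (λ _ → 1#) ≈ ∑≤ m (λ j → α ^ j * (stepWeight m j * s j))
    Z-total zero    s = solve 1 (λ s → s :* con 1 := con 1 :* (con 1 :* s) :+ con 0) refl (s 0)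
    Z-total (suc m) s = +-cong (solve 2 (λ s b → s :* (b :* con 1) := con 1 :* (b :* s)) refl (s 0) β) (begin
      α * Z m (s ∘ suc) (λ _ → 1#)
        ≈⟨ *-congˡ (Z-total m (s ∘ suc)) ⟩
      α * ∑≤ m (λ j → α ^ j * (stepWeight m j * s (suc j)))
        ≈⟨ ∑≤-*ˡ m α (λ j → α ^ j * (stepWeight m j * s (suc j))) ⟩
      ∑≤ m (λ j → α * (α ^ j * (stepWeight m j * s (suc j))))
        ≈⟨ ∑≤-cong m (λ {j} _ → sym (*-assoc α (α ^ j) (stepWeight m j * s (suc j)))) ⟩
      ∑≤ m (λ j → α * α ^ j * (stepWeight m j * s (suc j))) ∎)

    -- The closed forms as polynomials in β, and their recursion.

    polynomial : ℕ → (ℕ → ℤ) → Carrier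
    polynomial n a = ∑≤ n λ l → β ^ l * fromℤ (a l)

    polynomial-cong : ∀ n {a b} → (∀ {l} → l ≤ n → a l ≡ b l) → polynomial n a ≈ polynomial n b
    polynomial-cong n a≡b = ∑≤-cong n (λ {l} l≤n → *-congˡ {β ^ l} (reflexive (≡.cong fromℤ (a≡b l≤n))))

    polynomial-+ : ∀ n a b → polynomial n (λ l → a l ℤ.+ b l) ≈ polynomial n a + polynomial n b
    polynomial-+ n a b = trans (∑≤-cong n (λ {l} _ →
        trans (*-congˡ (fromℤ-+ (a l) (b l))) (distribˡ (β ^ l) (fromℤ (a l)) (fromℤ (b l)))))
      (∑≤-+ n (λ l → β ^ l * fromℤ (a l)) (λ l → β ^ l * fromℤ (b l)))

    polynomial-sum : ∀ n a b d → (∀ l → a l ℤ.+ b l ≡ d l) →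
      polynomial n a + polynomial n b ≈ polynomial n d
    polynomial-sum n a b d a+b≡d = trans (sym (polynomial-+ n a b))
      (polynomial-cong n {λ l → a l ℤ.+ b l} {d} (λ {l} _ → a+b≡d l))

    -- Here `m` is the width itself, one more than the parameter of `prefixCoeff`. Width 0
    -- contributes nothing because the last part must be positive.
    prefixPoly : ℕ → ℕ → ℕ → Carrier
    prefixPoly k zero    j = 0#
    prefixPoly k (suc m) j = polynomial k (prefixCoeff m k j)

    -- Below the diagonal the factor β shifts the degrees, and the constant coefficient is zero. On
    -- the diagonal nothing shifts, and the coefficient of degree `suc k` is zero.
    stepWeight-prefixPoly : ∀ k m j → j ≤ suc m →
      stepWeight (suc m) j * prefixPoly k (suc m) j ≈ polynomial (suc k) (coeff m k j)
    stepWeight-prefixPoly k m j j≤ with j ℕ.≟ suc m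
    ... | yes ≡.refl = begin
      stepWeight (suc m) (suc m) * polynomial k (prefixCoeff m k (suc m))
        ≡⟨ ≡.cong (_* polynomial k (prefixCoeff m k (suc m))) (stepWeight-refl (suc m)) ⟩
      1# * polynomial k (prefixCoeff m k (suc m))
        ≈⟨ *-identityˡ _ ⟩
      polynomial k (prefixCoeff m k (suc m))
        ≈⟨ polynomial-cong k {prefixCoeff m k (suc m)} {coeff m k (suc m)}
             (λ {l} l≤k → ≡.sym (coeff-diag m k l l≤k)) ⟩
      polynomial k (coeff m k (suc m))
        ≈⟨ +-identityʳ _ ⟨
      polynomial k (coeff m k (suc m)) + 0#
        ≈⟨ +-congˡ (zeroʳ (β ^ suc k)) ⟨
      polynomial k (coeff m k (suc m)) + β ^ suc k * fromℤ 0ℤ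
        ≡⟨ ≡.cong (λ a → polynomial k (coeff m k (suc m)) + β ^ suc k * fromℤ a) (coeff-diag-last m k) ⟨
      polynomial k (coeff m k (suc m)) + β ^ suc k * fromℤ (coeff m k (suc m) (suc k))
        ≈⟨ ∑≤-snoc k (λ l → β ^ l * fromℤ (coeff m k (suc m) l)) ⟨
      polynomial (suc k) (coeff m k (suc m)) ∎
    ... | no j≢ = begin
      stepWeight (suc m) j * polynomial k (prefixCoeff m k j)
        ≡⟨ ≡.cong (_* polynomial k (prefixCoeff m k j)) (stepWeight-≢ j≢) ⟩
      β * polynomial k (prefixCoeff m k j)
        ≈⟨ ∑≤-*ˡ k β (λ l → β ^ l * fromℤ (prefixCoeff m k j l)) ⟩
      ∑≤ k (λ l → β * (β ^ l * fromℤ (prefixCoeff m k j l)))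
        ≈⟨ ∑≤-cong k (λ {l} _ → trans (sym (*-assoc β (β ^ l) _))
             (*-congˡ (reflexive (≡.cong fromℤ (≡.sym (coeff-suc m k j l j<)))))) ⟩
      ∑≤ k (λ l → β ^ suc l * fromℤ (coeff m k j (suc l)))
        ≈⟨ +-identityˡ _ ⟨
      0# + ∑≤ k (λ l → β ^ suc l * fromℤ (coeff m k j (suc l)))
        ≈⟨ +-congʳ (trans (*-congˡ (reflexive (≡.cong fromℤ (coeff-zero m k j j<)))) (zeroʳ 1#)) ⟨
      polynomial (suc k) (coeff m k j) ∎
      where
      j< : j < suc m
      j< = ℕ.≤∧≢⇒< j≤ j≢

    prefixPoly-side : ∀ k m →
      polynomial (suc k) (coeff m k 0) + prefixPoly (suc k) m 0 ≈ prefixPoly (suc k) (suc m) 0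
    prefixPoly-side k zero    = trans (+-identityʳ _)
      (polynomial-cong (suc k) {coeff 0 k 0} {prefixCoeff 0 (suc k) 0} (λ {l} _ → prefixCoeff-origin k l))
    prefixPoly-side k (suc m) = polynomial-sum (suc k)
      (coeff (suc m) k 0) (prefixCoeff m (suc k) 0) (prefixCoeff (suc m) (suc k) 0) (prefixCoeff-side m k)

    prefixPoly-corner : ∀ k m j → j < m →
      polynomial (suc k) (coeff m k (suc j)) + (prefixPoly (suc k) (suc m) j + prefixPoly (suc k) m (suc j)) ≈
      prefixPoly (suc k) (suc m) (suc j) + prefixPoly (suc k) m j
    prefixPoly-corner k (suc m) j j<m = begin
      polynomial (suc k) a + (polynomial (suc k) b + polynomial (suc k) c′) ≈⟨ +-congˡ (polynomial-+ (suc k) b c′) ⟨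
      polynomial (suc k) a + polynomial (suc k) (λ l → b l ℤ.+ c′ l)
        ≈⟨ polynomial-sum (suc k) a (λ l → b l ℤ.+ c′ l) (λ l → d l ℤ.+ e l) (λ l → prefixCoeff-corner m k j l j<m) ⟩
      polynomial (suc k) (λ l → d l ℤ.+ e l) ≈⟨ polynomial-+ (suc k) d e ⟩
      polynomial (suc k) d + polynomial (suc k) e ∎
      where
      a = coeff (suc m) k (suc j)
      b = prefixCoeff (suc m) (suc k) j
      c′ = prefixCoeff m (suc k) (suc j)
      d = prefixCoeff (suc m) (suc k) (suc j)
      e = prefixCoeff m (suc k) j

    prefixPoly-edge : ∀ k m → polynomial (suc k) (coeff m k (suc m)) + prefixPoly (suc k) (suc m) m ≈
      prefixPoly (suc k) (suc m) (suc m)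
    prefixPoly-edge k m = polynomial-sum (suc k)
      (coeff m k (suc m)) (prefixCoeff m (suc k) m) (prefixCoeff m (suc k) (suc m)) (prefixCoeff-edge m k)

    -- Second rows of the full length `suc m` give the prefix sum, shorter ones the other term. The
    -- latter have room for at most m α's, hence the minimum.
    prefixPoly-rec : ∀ k m j → j ≤ suc m →
      prefixSum (suc m) (prefixPoly k (suc m)) j + prefixPoly (suc k) m (j ℕ.⊓ m) ≈ prefixPoly (suc k) (suc m) j
    prefixPoly-rec k m zero    _  =
      trans (+-congʳ (stepWeight-prefixPoly k m 0 z≤n)) (prefixPoly-side k m)
    prefixPoly-rec k m (suc j) (s≤s j≤m) with j ℕ.≟ m
    ... | yes ≡.refl rewrite ℕ.m≥n⇒m⊓n≡n (ℕ.n≤1+n m) = begin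
      A + stepWeight (suc m) (suc m) * U (suc m) + u m
        ≈⟨ +-congʳ (+-congˡ (stepWeight-prefixPoly k m (suc m) ℕ.≤-refl)) ⟩
      A + C + u m
        ≈⟨ solve 3 (λ a b u → a :+ b :+ u := b :+ (a :+ u)) refl A C (u m) ⟩
      C + (A + u m)
        ≡⟨ ≡.cong (λ i → C + (A + u i)) (ℕ.⊓-idem m) ⟨
      C + (A + u (m ℕ.⊓ m))
        ≈⟨ +-congˡ (prefixPoly-rec k m m (ℕ.n≤1+n m)) ⟩
      C + prefixPoly (suc k) (suc m) m
        ≈⟨ prefixPoly-edge k m ⟩
      prefixPoly (suc k) (suc m) (suc m) ∎
      where
      U = prefixPoly k (suc m)
      u = prefixPoly (suc k) m
      A = prefixSum (suc m) U m
      C = polynomial (suc k) (coeff m k (suc m))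
    -- Adding `u j` to both sides creates the left side of the induction hypothesis and then the
    -- four terms of the corner identity.
    ... | no j≢m rewrite ℕ.m≤n⇒m⊓n≡m (ℕ.≤∧≢⇒< j≤m j≢m) = +-cancelʳ (u j) _ _ (begin
      A + stepWeight (suc m) (suc j) * U (suc j) + u (suc j) + u j
        ≈⟨ +-congʳ (+-congʳ (+-congˡ (stepWeight-prefixPoly k m (suc j) (s≤s j≤m)))) ⟩
      A + C + u (suc j) + u j
        ≈⟨ solve 4 (λ a b u v → a :+ b :+ u :+ v := b :+ (a :+ v :+ u)) refl A C (u (suc j)) (u j) ⟩
      C + (A + u j + u (suc j))
        ≡⟨ ≡.cong (λ i → C + (A + u i + u (suc j))) (ℕ.m≤n⇒m⊓n≡m j≤m) ⟨
      C + (A + u (j ℕ.⊓ m) + u (suc j))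
        ≈⟨ +-congˡ (+-congʳ (prefixPoly-rec k m j (ℕ.m≤n⇒m≤1+n j≤m))) ⟩
      C + (prefixPoly (suc k) (suc m) j + u (suc j))
        ≈⟨ prefixPoly-corner k m j (ℕ.≤∧≢⇒< j≤m j≢m) ⟩
      prefixPoly (suc k) (suc m) (suc j) + u j ∎)
      where
      U = prefixPoly k (suc m)
      u = prefixPoly (suc k) m
      A = prefixSum (suc m) U j
      C = polynomial (suc k) (coeff m k (suc j))

    -- Here p is the length of the top row and q that of the row beneath it. In the step from p to
    -- `suc p`, the lengths q ≤ p follow by induction at `widen φ`, and q = `suc p` is the
    -- composition `Z-E`.
    Z-sum : ∀ k p φ → ∑≤ p (λ q → Z q (prefixPoly k q) (λ f → E (f ℕ.+ (p ∸ q)) φ)) ≈ Z p (prefixPoly (suc k) p) φ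
    Z-sum k zero    φ = trans (+-identityʳ _) (trans (zeroˡ _) (sym (zeroˡ _)))
    Z-sum k (suc p) φ = begin
      ∑≤ (suc p) (λ q → Z q (prefixPoly k q) (λ f → E (f ℕ.+ (suc p ∸ q)) φ))
        ≈⟨ ∑≤-snoc p (λ q → Z q (prefixPoly k q) (λ f → E (f ℕ.+ (suc p ∸ q)) φ)) ⟩
      ∑≤ p (λ q → Z q (prefixPoly k q) (λ f → E (f ℕ.+ (suc p ∸ q)) φ)) +
        Z (suc p) (prefixPoly k (suc p)) (λ f → E (f ℕ.+ (p ∸ p)) φ)
        ≈⟨ +-cong
             (∑≤-cong p (λ {q} q≤p → Z-cong q {prefixPoly k q} (λ _ → refl) (λ {f} _ → E-+suc q f q≤p)))
             (Z-cong (suc p) {prefixPoly k (suc p)} (λ _ → refl) (λ {f} _ →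
               reflexive (≡.cong (λ g → E g φ) (≡.trans (≡.cong (f ℕ.+_) (ℕ.n∸n≡0 p)) (ℕ.+-identityʳ f))))) ⟩
      ∑≤ p (λ q → Z q (prefixPoly k q) (λ f → E (f ℕ.+ (p ∸ q)) (widen φ))) +
        Z (suc p) (prefixPoly k (suc p)) (λ f → E f φ)
        ≈⟨ +-cong (trans (Z-sum k p (widen φ)) (Z-widen p (prefixPoly (suc k) p) φ))
             (Z-E (suc p) (prefixPoly k (suc p)) φ) ⟩
      Z (suc p) (λ j → prefixPoly (suc k) p (j ℕ.⊓ p)) φ + Z (suc p) (prefixSum (suc p) (prefixPoly k (suc p))) φ
        ≈⟨ trans (+-comm _ _) (Z-+ (suc p) (prefixSum (suc p) (prefixPoly k (suc p)))
             (λ j → prefixPoly (suc k) p (j ℕ.⊓ p)) φ) ⟩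
      Z (suc p) (λ j → prefixSum (suc p) (prefixPoly k (suc p)) j + prefixPoly (suc k) p (j ℕ.⊓ p)) φ
        ≈⟨ Z-cong (suc p) (λ {j} j≤ → prefixPoly-rec k p j j≤) (λ _ → refl) ⟩
      Z (suc p) (prefixPoly (suc k) (suc p)) φ ∎
      where
      E-+suc : ∀ q f → q ≤ p → E (f ℕ.+ (suc p ∸ q)) φ ≈ E (f ℕ.+ (p ∸ q)) (widen φ)
      E-+suc q f q≤p = trans
        (reflexive (≡.cong (λ g → E g φ) (≡.trans (≡.cong (f ℕ.+_) (ℕ.+-∸-assoc 1 q≤p)) (ℕ.+-suc f (p ∸ q)))))
        (sym (E-widen (f ℕ.+ (p ∸ q)) φ))

    E≈Z-prefixPoly : ∀ m φ → E (suc m) φ ≈ Z (suc m) (prefixPoly 0 (suc m)) φ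
    E≈Z-prefixPoly m φ = Z-cong (suc m) (λ {j} _ → sym (begin
      1# * fromℤ (prefixCoeff m 0 j 0) + 0#  ≡⟨ ≡.cong (λ a → 1# * fromℤ a + 0#) (prefixCoeff-0 m j) ⟩
      1# * (1# + 0#) + 0#                     ≈⟨ solve 0 (con 1 :* (con 1 :+ con 0) :+ con 0 := con 1) refl ⟩
      1# ∎)) (λ _ → refl)

    -- Summation over the fillings of a row and of a shape.

    rowWeight : ∀ {p} → Vec Cell p → Carrier
    rowWeight w = α ^ Vec.count (_≟ᶜ αᶜ) w * β ^ Vec.count (_≟ᶜ βᶜ) w

    -- The cell split off is the leftmost one. If its column is blocked it is empty and `φ` is
    -- unchanged; otherwise it replaces `φ` by `widen φ`.
    sum-rows : ∀ p (b : ℕ → Bool) (φ : ℕ → Carrier) →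
      listSum (λ w → when (T? (rowOK b w)) (rowWeight w * φ (freeAfter b w))) (words (αᶜ ∷ βᶜ ∷ empty ∷ []) p) ≈
      E (freeCount b p) φ
    sum-rows zero    b φ = solve 1 (λ x → con 1 :* con 1 :* x :+ con 0 := con 1 :* x) refl (φ 0)
    sum-rows (suc p) b φ = begin
      listSum g (words cells (suc p))
        ≈⟨ listSum-cartesianProductWith g _∷_ cells (words cells p) ⟩
      listSum (λ x → listSum (λ w → g (x ∷ w)) (words cells p)) cells
        ≈⟨ listSum-swap (λ x w → g (x ∷ w)) cells (words cells p) ⟩
      listSum (λ w → listSum (λ x → g (x ∷ w)) cells) (words cells p)
        ≈⟨ listSum-cong first-cell (words cells p) ⟩
      listSum (λ w → when (T? (rowOK (b ∘ suc) w)) (rowWeight w * ψ (freeAfter (b ∘ suc) w))) (words cells p)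
        ≈⟨ sum-rows p (b ∘ suc) ψ ⟩
      E (freeCount (b ∘ suc) p) ψ
        ≈⟨ E-ψ ⟩
      E (freeCount b (suc p)) φ ∎
      where
      cells = αᶜ ∷ βᶜ ∷ empty ∷ []
      g : Vec Cell (suc p) → Carrier
      g w = when (T? (rowOK b w)) (rowWeight w * φ (freeAfter b w))
      ψ : ℕ → Carrier
      ψ = if b 0 then φ else widen φ
      E-ψ : E (freeCount (b ∘ suc) p) ψ ≈ E (freeCount b (suc p)) φ
      E-ψ with b 0
      ... | true  = refl
      ... | false = E-widen _ φ
      first-cell : ∀ w → listSum (λ x → g (x ∷ w)) cells ≈
        when (T? (rowOK (b ∘ suc) w)) (rowWeight w * ψ (freeAfter (b ∘ suc) w))
      first-cell w with rowOK (b ∘ suc) w | hasβ≡0<freeAfter (b ∘ suc) w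
      ... | false | _ = solve 0 (con 0 :+ (con 0 :+ (con 0 :+ con 0)) := con 0) refl
      ... | true  | eq with b 0
      ...   | true = solve 1 (λ x → con 0 :+ (con 0 :+ (x :+ con 0)) := x) refl _
      -- The equation leaves two cases: a β with a free column, where the cell is empty, or neither,
      -- where α and β give the two summands of `widen φ 0`.
      ...   | false with hasβ w | freeAfter (b ∘ suc) w | eq _
      ...     | true  | suc f | _ = solve 1 (λ x → con 0 :+ (con 0 :+ (x :+ con 0)) := x) refl _
      ...     | false | zero  | _ = solve 6 (λ a b x y s t →
                  (a :* x) :* y :* s :+ (x :* (b :* y) :* t :+ (con 0 :+ con 0)) := x :* y :* (a :* s :+ b :* t)) refl
                  α β (α ^ Vec.count (_≟ᶜ αᶜ) w) (β ^ Vec.count (_≟ᶜ βᶜ) w) (φ 0) (φ 1)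

    fillingWeight : ∀ {k} {μ : Vec ℕ k} → Filling μ → Carrier
    fillingWeight {μ = μ} T′ = α ^ count αᶜ (μ , T′) * β ^ count βᶜ (μ , T′)

    fillingWeight-∷ : ∀ {k p} {μ : Vec ℕ k} (w : Vec Cell p) (T′ : Filling μ) →
      fillingWeight {μ = p ∷ μ} (w ∷ T′) ≈ fillingWeight T′ * rowWeight w
    fillingWeight-∷ w T′ = trans
      (*-cong (^-homo-* α (Vec.count (_≟ᶜ αᶜ) w) _) (^-homo-* β (Vec.count (_≟ᶜ βᶜ) w) _))
      (solve 4 (λ a b c d → (a :* b) :* (c :* d) := (b :* d) :* (a :* c)) refl _ _ _ _)

    shapeSum : ∀ {k} (μ : Vec ℕ k) → (Filling μ → Carrier) → Carrier
    shapeSum μ φ = listSum (λ T′ → when (isCondensedCatalan? T′) (fillingWeight T′ * φ T′)) (fillings μ)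

    shapeSum-cong : ∀ {k} (μ : Vec ℕ k) {φ ψ} → (∀ T′ → φ T′ ≈ ψ T′) → shapeSum μ φ ≈ shapeSum μ ψ
    shapeSum-cong μ φ≈ψ = listSum-cong (λ T′ → when-cong (isCondensedCatalan? T′) (λ _ → *-congˡ (φ≈ψ T′))) (fillings μ)

    shapeSum-∷ : ∀ {k} p (μ : Vec ℕ k) (φ : ℕ → Carrier) →
      shapeSum (p ∷ μ) (λ T′ → φ (freeCount (blocked T′) p)) ≈
      shapeSum μ (λ T′ → E (freeCount (blocked T′) p) φ)
    shapeSum-∷ p μ φ = begin
      shapeSum (p ∷ μ) (λ T′ → φ (freeCount (blocked T′) p))
        ≈⟨ listSum-cartesianProductWith g _∷_ rows (fillings μ) ⟩
      listSum (λ w → listSum (λ T′ → g (w ∷ T′)) (fillings μ)) rows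
        ≈⟨ listSum-swap (λ w T′ → g (w ∷ T′)) rows (fillings μ) ⟩
      listSum (λ T′ → listSum (λ w → g (w ∷ T′)) rows) (fillings μ)
        ≈⟨ listSum-cong (λ T′ → begin
             listSum (λ w → g (w ∷ T′)) rows
               ≈⟨ listSum-cong (split T′) rows ⟩
             listSum (λ w → when (isCondensedCatalan? T′) (fillingWeight T′ * h T′ w)) rows
               ≈⟨ listSum-when (isCondensedCatalan? T′) (λ w → fillingWeight T′ * h T′ w) rows ⟩
             when (isCondensedCatalan? T′) (listSum (λ w → fillingWeight T′ * h T′ w) rows)
               ≈⟨ when-cong (isCondensedCatalan? T′) (λ _ → trans
                    (sym (listSum-*ˡ (fillingWeight T′) (h T′) rows))
                    (*-congˡ (sum-rows p (blocked T′) φ))) ⟩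
             when (isCondensedCatalan? T′) (fillingWeight T′ * E (freeCount (blocked T′) p) φ) ∎)
           (fillings μ) ⟩
      shapeSum μ (λ T′ → E (freeCount (blocked T′) p) φ) ∎
      where
      rows = words (αᶜ ∷ βᶜ ∷ empty ∷ []) p
      g : Filling (p ∷ μ) → Carrier
      g T′ = when (isCondensedCatalan? T′) (fillingWeight T′ * φ (freeCount (blocked T′) p))
      h : Filling μ → Vec Cell p → Carrier
      h T′ w = when (T? (rowOK (blocked T′) w)) (rowWeight w * φ (freeAfter (blocked T′) w))
      split : ∀ T′ w → g (w ∷ T′) ≈ when (isCondensedCatalan? T′) (fillingWeight T′ * h T′ w)
      split T′ w = begin
        when (isCondensedCatalan? {μ = p ∷ μ} (w ∷ T′)) (fillingWeight {μ = p ∷ μ} (w ∷ T′) * y)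
          ≈⟨ when-⇔ (isCondensedCatalan-∷ w T′) (isCondensedCatalan? {μ = p ∷ μ} (w ∷ T′))
               (isCondensedCatalan? T′ ×-dec ok) _ ⟩
        when (isCondensedCatalan? T′ ×-dec ok) (fillingWeight {μ = p ∷ μ} (w ∷ T′) * y)
          ≈⟨ when-× (isCondensedCatalan? T′) ok _ ⟩
        when (isCondensedCatalan? T′) (when ok (fillingWeight {μ = p ∷ μ} (w ∷ T′) * y))
          ≈⟨ when-cong (isCondensedCatalan? T′) (λ _ → trans
               (when-cong ok (λ _ → trans (*-congʳ (fillingWeight-∷ w T′)) (*-assoc _ _ _)))
               (sym (when-* ok _ _))) ⟩
        when (isCondensedCatalan? T′) (fillingWeight T′ * when ok (rowWeight w * y)) ∎
        where
        ok = T? (rowOK (blocked T′) w)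
        y = φ (freeAfter (blocked T′) w)

    -- Summation over shapes.

    partSum : ∀ {k} p (μ : Vec ℕ k) (φ : ℕ → Carrier) → Carrier
    partSum p μ φ = shapeSum (p ∷ μ) (λ T′ → φ (freeCount (blocked T′) p))

    -- Weakly decreasing parts keep all lower α's within the first q columns, so the remaining
    -- `p ∸ q` columns of the new row are free.
    partSum-∷ : ∀ {k} p q (μ : Vec ℕ k) φ → q ≤ p → Linked _≥_ (q ∷ μ) →
      partSum p (q ∷ μ) φ ≈ partSum q μ (λ f → E (f ℕ.+ (p ∸ q)) φ)
    partSum-∷ p q μ φ q≤p dec = trans (shapeSum-∷ p (q ∷ μ) φ) (shapeSum-cong (q ∷ μ) (λ T′ →
      reflexive (≡.cong (λ f → E f φ)
        (freeCount-extend (blocked T′) q≤p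
          (blocked-beyond T′ (Linked⇒All (λ q≥r r≥s → ℕ.≤-trans r≥s q≥r) ℕ.≤-refl dec))))))

    full? : ∀ {k} p (μ : Vec ℕ k) → Dec (Linked _≥_ (p ∷ μ) × 1 ≤ Vec.last (p ∷ μ))
    full? p μ = linked? ℕ._≥?_ (p ∷ μ) ×-dec 1 ℕ.≤? Vec.last (p ∷ μ)

    -- The bound `M` on the listed parts stays fixed while `p` runs through the lengths of
    -- successive rows; monotonicity cuts the lists down to the parts at most `p`.
    shapesSum : ℕ → ℕ → ℕ → (ℕ → Carrier) → Carrier
    shapesSum M k p φ = listSum (λ μ → when (full? p μ) (partSum p μ φ)) (words (upTo (suc M)) k)

    shapesSum-zero : ∀ M p φ → shapesSum M 0 p φ ≈ when (1 ℕ.≤? p) (E p φ)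
    shapesSum-zero M p φ = trans (+-identityʳ _) (when-cong (1 ℕ.≤? p) (λ _ → trans (shapeSum-∷ p [] φ) (begin
      1# * 1# * E (freeCount (λ _ → false) p) φ + 0#
        ≈⟨ solve 1 (λ x → con 1 :* con 1 :* x :+ con 0 := x) refl _ ⟩
      E (freeCount (λ _ → false) p) φ
        ≡⟨ ≡.cong (λ f → E f φ) (freeCount-extend (λ _ → false) {p = p} z≤n (λ _ → ≡.refl)) ⟩
      E p φ ∎)))

    shapesSum-suc : ∀ M k p φ → p ≤ M →
      shapesSum M (suc k) p φ ≈ ∑≤ p (λ q → shapesSum M k q (λ f → E (f ℕ.+ (p ∸ q)) φ))
    shapesSum-suc M k p φ p≤M = begin
      listSum (λ μ → when (full? p μ) (partSum p μ φ)) (words (upTo (suc M)) (suc k))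
        ≈⟨ listSum-cartesianProductWith (λ μ → when (full? p μ) (partSum p μ φ)) _∷_
             (upTo (suc M)) (words (upTo (suc M)) k) ⟩
      listSum (λ q → listSum (λ μ → when (full? p (q ∷ μ)) (partSum p (q ∷ μ) φ)) (words (upTo (suc M)) k))
        (upTo (suc M))
        ≈⟨ listSum-cong (λ q → trans
             (listSum-cong (split q) (words (upTo (suc M)) k))
             (listSum-when (q ℕ.≤? p) _ (words (upTo (suc M)) k))) (upTo (suc M)) ⟩
      listSum (λ q → when (q ℕ.≤? p) (shapesSum M k q (λ f → E (f ℕ.+ (p ∸ q)) φ))) (upTo (suc M))
        ≈⟨ listSum-applyUpTo _ (λ q → q) M ⟩
      ∑≤ M (λ q → when (q ℕ.≤? p) (shapesSum M k q (λ f → E (f ℕ.+ (p ∸ q)) φ)))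
        ≈⟨ ∑≤-truncate M p (λ q → shapesSum M k q (λ f → E (f ℕ.+ (p ∸ q)) φ)) p≤M ⟩
      ∑≤ p (λ q → shapesSum M k q (λ f → E (f ℕ.+ (p ∸ q)) φ)) ∎
      where
      split : ∀ q μ → when (full? p (q ∷ μ)) (partSum p (q ∷ μ) φ) ≈
        when (q ℕ.≤? p) (when (full? q μ) (partSum q μ (λ f → E (f ℕ.+ (p ∸ q)) φ)))
      split q μ = begin
        when (full? p (q ∷ μ)) (partSum p (q ∷ μ) φ)
          ≈⟨ when-⇔ (mk⇔ (λ where (q≤p ∷ dec , 1≤) → q≤p , dec , 1≤) (λ (q≤p , dec , 1≤) → q≤p ∷ dec , 1≤))
               (full? p (q ∷ μ)) (q ℕ.≤? p ×-dec full? q μ) _ ⟩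
        when (q ℕ.≤? p ×-dec full? q μ) (partSum p (q ∷ μ) φ)
          ≈⟨ when-× (q ℕ.≤? p) (full? q μ) _ ⟩
        when (q ℕ.≤? p) (when (full? q μ) (partSum p (q ∷ μ) φ))
          ≈⟨ when-cong (q ℕ.≤? p) (λ q≤p → when-cong (full? q μ) (λ (dec , _) → partSum-∷ p q μ φ q≤p dec)) ⟩
        when (q ℕ.≤? p) (when (full? q μ) (partSum q μ (λ f → E (f ℕ.+ (p ∸ q)) φ))) ∎

    -- The weight `φ` has to be arbitrary, since removing the top row replaces it by a weight built
    -- from `E`.
    shapesSum≈Z : ∀ M k p φ → p ≤ M → shapesSum M k p φ ≈ Z p (prefixPoly k p) φ
    shapesSum≈Z M zero    zero    φ _   = trans (shapesSum-zero M 0 φ) (sym (zeroˡ _))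
    shapesSum≈Z M zero    (suc p) φ _   = trans (shapesSum-zero M (suc p) φ) (E≈Z-prefixPoly p φ)
    shapesSum≈Z M (suc k) p       φ p≤M = begin
      shapesSum M (suc k) p φ
        ≈⟨ shapesSum-suc M k p φ p≤M ⟩
      ∑≤ p (λ q → shapesSum M k q (λ f → E (f ℕ.+ (p ∸ q)) φ))
        ≈⟨ ∑≤-cong p (λ {q} q≤p → shapesSum≈Z M k q (λ f → E (f ℕ.+ (p ∸ q)) φ) (ℕ.≤-trans q≤p p≤M)) ⟩
      ∑≤ p (λ q → Z q (prefixPoly k q) (λ f → E (f ℕ.+ (p ∸ q)) φ))
        ≈⟨ Z-sum k p φ ⟩
      Z p (prefixPoly (suc k) p) φ ∎

    -- With `n` a variable, matching on the equation replaces `m` by `n ∸ suc k`, the very bound and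
    -- exponent occurring in `tableaux` and `wt`.
    tableauSum : ∀ n k m → n ∸ suc k ≡ m →
      listSum (wt α β (suc k) n) (filter (isFull? m ∘ proj₁) (tableaux (suc k) n)) ≈
      α ^ suc k * β ^ m * shapesSum m k m (λ _ → 1#)
    tableauSum n k m ≡.refl = begin
      listSum (wt α β (suc k) n) (filter (isFull? m ∘ proj₁) (tableaux (suc k) n))
        ≈⟨ listSum-filter (isFull? m ∘ proj₁) _ (tableaux (suc k) n) ⟩
      listSum (λ T′ → when (isFull? m (proj₁ T′)) (wt α β (suc k) n T′)) (tableaux (suc k) n)
        ≈⟨ listSum-filter (isTableau? (suc k) n) (λ T′ → when (isFull? m (proj₁ T′)) (wt α β (suc k) n T′))
             (concatMap (λ μ → List.map (μ ,_) (fillings μ)) (words (upTo (suc m)) (suc k))) ⟩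
      listSum g (concatMap (λ μ → List.map (μ ,_) (fillings μ)) (words (upTo (suc m)) (suc k)))
        ≈⟨ listSum-concatMap g (λ μ → List.map (μ ,_) (fillings μ)) (words (upTo (suc m)) (suc k)) ⟩
      listSum (λ μ → listSum g (List.map (μ ,_) (fillings μ))) (words (upTo (suc m)) (suc k))
        ≈⟨ listSum-cong (λ μ → reflexive (listSum-map g (μ ,_) (fillings μ))) (words (upTo (suc m)) (suc k)) ⟩
      listSum (λ μ → listSum (λ T′ → g (μ , T′)) (fillings μ)) (words (upTo (suc m)) (suc k))
        ≈⟨ listSum-cartesianProductWith _ _∷_ (upTo (suc m)) (words (upTo (suc m)) k) ⟩
      listSum (λ p → listSum (λ μ → listSum (λ T′ → g (p ∷ μ , T′)) (fillings (p ∷ μ))) (words (upTo (suc m)) k))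
        (upTo (suc m))
        ≈⟨ listSum-cong (λ p → trans
             (listSum-cong (λ μ → shape p μ) (words (upTo (suc m)) k))
             (trans (listSum-when (p ℕ.≟ m) _ (words (upTo (suc m)) k))
               (when-cong (p ℕ.≟ m) (λ _ → sym (listSum-*ˡ x _ (words (upTo (suc m)) k)))))) (upTo (suc m)) ⟩
      listSum (λ p → when (p ℕ.≟ m) (x * shapesSum m k p (λ _ → 1#))) (upTo (suc m))
        ≈⟨ listSum-applyUpTo _ (λ p → p) m ⟩
      ∑≤ m (λ p → when (p ℕ.≟ m) (x * shapesSum m k p (λ _ → 1#)))
        ≈⟨ ∑≤-pick m (λ p → x * shapesSum m k p (λ _ → 1#)) ⟩
      x * shapesSum m k m (λ _ → 1#) ∎
      where
      x = α ^ suc k * β ^ m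
      g : Filled (suc k) → Carrier
      g T′ = when (isTableau? (suc k) n T′) (when (isFull? m (proj₁ T′)) (wt α β (suc k) n T′))

      wt≈ : ∀ {μ} (T′ : Filling μ) → wt α β (suc k) n (μ , T′) ≈ x * (fillingWeight T′ * 1#)
      wt≈ {μ} T′ = trans (*-cong (^-homo-* α (suc k) _) (^-homo-* β m _))
        (solve 4 (λ a b c d → (a :* b) :* (c :* d) := (a :* c) :* ((b :* d) :* con 1)) refl _ _ _ _)

      regroup : ∀ p (μ : Vec ℕ k) T′ →
        (IsTableau (suc k) n (p ∷ μ , T′) × IsFull m (p ∷ μ)) ⇔
        (p ≡ m × (Linked _≥_ (p ∷ μ) × 1 ≤ Vec.last (p ∷ μ)) × IsCondensedCatalan T′)
      regroup p μ T′ = mk⇔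
        (λ (((dec , _) , cc) , p≡m , 1≤) → p≡m , (dec , 1≤) , cc)
        -- The bound on all parts is recovered from the first part and the weak decrease.
        (λ (p≡m , (dec , 1≤) , cc) →
          ((dec , Linked⇒All (λ q≥r r≥s → ℕ.≤-trans r≥s q≥r) (ℕ.≤-reflexive p≡m) dec) , cc) , p≡m , 1≤)

      cell : ∀ p (μ : Vec ℕ k) T′ → g (p ∷ μ , T′) ≈
        when (p ℕ.≟ m) (when (full? p μ) (x * when (isCondensedCatalan? T′) (fillingWeight T′ * 1#)))
      cell p μ T′ = begin
        g (p ∷ μ , T′)
          ≈⟨ when-× (isTableau? (suc k) n (p ∷ μ , T′)) (isFull? m (p ∷ μ)) _ ⟨
        when (isTableau? (suc k) n (p ∷ μ , T′) ×-dec isFull? m (p ∷ μ)) y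
          ≈⟨ when-⇔ (regroup p μ T′) (isTableau? (suc k) n (p ∷ μ , T′) ×-dec isFull? m (p ∷ μ))
               (p ℕ.≟ m ×-dec full? p μ ×-dec isCondensedCatalan? T′) y ⟩
        when (p ℕ.≟ m ×-dec full? p μ ×-dec isCondensedCatalan? T′) y
          ≈⟨ when-× (p ℕ.≟ m) (full? p μ ×-dec isCondensedCatalan? T′) y ⟩
        when (p ℕ.≟ m) (when (full? p μ ×-dec isCondensedCatalan? T′) y)
          ≈⟨ when-cong (p ℕ.≟ m) (λ _ → trans (when-× (full? p μ) (isCondensedCatalan? T′) y)
               (when-cong (full? p μ) (λ _ → trans (when-cong (isCondensedCatalan? T′) (λ _ → wt≈ T′))
                 (sym (when-* (isCondensedCatalan? T′) x _))))) ⟩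
        when (p ℕ.≟ m) (when (full? p μ) (x * when (isCondensedCatalan? T′) (fillingWeight T′ * 1#))) ∎
        where y = wt α β (suc k) n (p ∷ μ , T′)

      shape : ∀ p (μ : Vec ℕ k) → listSum (λ T′ → g (p ∷ μ , T′)) (fillings (p ∷ μ)) ≈
        when (p ℕ.≟ m) (x * when (full? p μ) (partSum p μ (λ _ → 1#)))
      shape p μ = begin
        listSum (λ T′ → g (p ∷ μ , T′)) (fillings (p ∷ μ))
          ≈⟨ listSum-cong (cell p μ) (fillings (p ∷ μ)) ⟩
        listSum (λ T′ → when (p ℕ.≟ m) (when (full? p μ) (x * h T′))) (fillings (p ∷ μ))
          ≈⟨ listSum-when (p ℕ.≟ m) _ (fillings (p ∷ μ)) ⟩
        when (p ℕ.≟ m) (listSum (λ T′ → when (full? p μ) (x * h T′)) (fillings (p ∷ μ)))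
          ≈⟨ when-cong (p ℕ.≟ m) (λ _ → trans (listSum-when (full? p μ) _ (fillings (p ∷ μ)))
               (trans (when-cong (full? p μ) (λ _ → sym (listSum-*ˡ x h (fillings (p ∷ μ)))))
                 (sym (when-* (full? p μ) x _)))) ⟩
        when (p ℕ.≟ m) (x * when (full? p μ) (partSum p μ (λ _ → 1#))) ∎
        where
        h : Filling (p ∷ μ) → Carrier
        h T′ = when (isCondensedCatalan? T′) (fillingWeight T′ * 1#)

    N′≈∑coeff : ∀ m k → N′ (suc m) (suc k) α β ≈
      α ^ suc k * β ^ suc m * ∑≤ (suc k) λ l → ∑≤ (suc m) λ j → α ^ j * β ^ l * fromℤ (coeff m k j l)
    N′≈∑coeff m k = begin
      N′ (suc m) (suc k) α β
        ≈⟨ tableauSum (suc k ℕ.+ suc m) k (suc m) (ℕ.m+n∸m≡n (suc k) (suc m)) ⟩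
      x * shapesSum (suc m) k (suc m) (λ _ → 1#)
        ≈⟨ *-congˡ (shapesSum≈Z (suc m) k (suc m) (λ _ → 1#) ℕ.≤-refl) ⟩
      x * Z (suc m) (prefixPoly k (suc m)) (λ _ → 1#)
        ≈⟨ *-congˡ (Z-total (suc m) (prefixPoly k (suc m))) ⟩
      x * ∑≤ (suc m) (λ j → α ^ j * (stepWeight (suc m) j * prefixPoly k (suc m) j))
        ≈⟨ *-congˡ (∑≤-cong (suc m) {λ j → α ^ j * (stepWeight (suc m) j * prefixPoly k (suc m) j)} {row}
             (λ {j} j≤ → *-congˡ {α ^ j} (stepWeight-prefixPoly k m j j≤))) ⟩
      x * ∑≤ (suc m) row
        ≈⟨ *-congˡ (∑≤-cong (suc m) {row} {λ j → ∑≤ (suc k) (term j)} (λ {j} _ → trans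
             (∑≤-*ˡ (suc k) (α ^ j) (λ l → β ^ l * fromℤ (coeff m k j l)))
             (∑≤-cong (suc k) {λ l → α ^ j * (β ^ l * fromℤ (coeff m k j l))} {term j}
               (λ {l} _ → sym (*-assoc (α ^ j) (β ^ l) _))))) ⟩
      x * ∑≤ (suc m) (λ j → ∑≤ (suc k) (term j))
        ≈⟨ *-congˡ (∑≤-swap (suc m) (suc k) term) ⟩
      x * ∑≤ (suc k) (λ l → ∑≤ (suc m) (λ j → term j l)) ∎
      where
      x = α ^ suc k * β ^ suc m
      row : ℕ → Carrier
      row j = α ^ j * polynomial (suc k) (coeff m k j)
      term : ℕ → ℕ → Carrier
      term j l = α ^ j * β ^ l * fromℤ (coeff m k j l)

open import Data.Nat.Base using (suc)
open import Relation.Binary.PropositionalEquality using (cong)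

theorem6p1 : ∀ {c ℓ} (R : CommutativeRing c ℓ) →
  let open CommutativeRing R
      open Over R in
  (m k : ℕ) .{{_ : NonZero m}} .{{_ : NonZero k}} (α β : Carrier) →
  N′ m k α β ≈
    α ^ k * β ^ m * ∑≤ k λ l → ∑≤ m λ j →
      α ^ j * β ^ l * fromℤ
        (binom (+ m ℤ.+ + l ℤ.- + 2 ℤ.+ δ j m) (+ m ℤ.- + 1)
           ℤ.* binom (+ k ℤ.+ + j ℤ.- + 2 ℤ.+ δ l k) (+ k ℤ.- + 1)
         ℤ.- binom (+ m ℤ.+ + l ℤ.- + 2 ℤ.+ δ j m) (+ m)
           ℤ.* binom (+ k ℤ.+ + j ℤ.- + 2 ℤ.+ δ l k) (+ k))
theorem6p1 R (suc m) (suc k) α β = trans (N′≈∑coeff α β m k) (*-congˡ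
  (∑≤-cong (suc k) (λ {l} l≤ → ∑≤-cong (suc m) (λ {j} j≤ →
    *-congˡ {α ^ j * β ^ l} (reflexive (cong fromℤ (coeff≡binom m k j l j≤ l≤)))))))
  where
  open CommutativeRing R
  open Over R
  open Coefficients using (coeff≡binom)
  open GeneratingFunction R
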